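{- The parameterized problem $k$-Base-Size is $\mathsf{MINI[1]}$-hard, even when the input is restricted to permutation groups that are elementary $2$-groups.
   Context: For a permutation group $G\le S_n$ on $[n]=\{1,\dots,n\}$, a base of $G$ is a subset $S\subset[n]$ such that no nontrivial permutation of $G$ fixes each point in $S$ (i.e. the pointwise stabilizer $\{g\in G\mid i^g=i\ \forall i\in S\}$ is trivial). $k$-Base-Size. Input: a generating set for a permutation group $G$ on $[n]$ and an integer $k$. Parameter: $k$. Question: is there a subset $S\subset[n]$ of size $k$ such that no nontrivial permutation of $G$ fixes each point in $S$? Mini-3SAT. Input: a formula $F$ in 3-CNF of size bounded by $k\log n$, and the number $n$ in unary. Parameter: $k$. Question: is there a boolean assignment to the variables that satisfies $F$? $\mathsf{MINI[1]}$ is the class of all parameterized problems that are FPT (many-one) reducible to Mini-3SAT. A parameterized problem is $\mathsf{MINI[1]}$-hard if every problem in $\mathsf{MINI[1]}$ is FPT (many-one) reducible to it. An elementary $2$-group is a group isomorphic to $\mathbb{F}_2^m$ (additive) for some $m$. -}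

module Defs where

open import Algebra.Bundles using (Group)
open import Algebra.Construct.Pointwise as Pointwise using ()
open import Algebra.Morphism.Structures using (module GroupMorphisms)
open import Data.Bool.Base using (Bool; true; false)
open import Data.Fin.Base using (Fin; toℕ)
open import Data.Fin.Permutation as Perm
  using (Permutation′; _≈_; _∘ₚ_; _⟨$⟩ʳ_; _⟨$⟩ˡ_)
open import Data.Fin.Subset using (Subset; _∈_; ∣_∣)
open import Data.List.Base using (List; []; _∷_; length; map; sum; tabulate)
open import Data.List.Membership.Propositional using () renaming (_∈_ to _∈ˡ_)
open import Data.List.Relation.Unary.All using (All)
open import Data.List.Relation.Unary.Any using (Any)
open import Data.Nat.Base using (ℕ; zero; suc; _+_; _*_; _^_; _≤_; NonZero)
open import Data.Parity.Properties using (+-0-group)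
open import Data.Product.Base using (Σ-syntax; ∃-syntax; _×_; _,_)
open import Data.Unit.Base using (⊤)
open import Function.Base using (_∘_)
open import Function.Bundles using (_⇔_)
open import Level using (0ℓ)
open import Relation.Binary.PropositionalEquality using (_≡_; _≢_; refl; sym; trans; cong)

------------------------------------------------------------------------
-- Model of computation: N. D. Jones's one-variable WHILE language "I"
-- over binary trees with a single atom (Computability and Complexity
-- from a Programming Perspective), with a primitive conditional.

infixr 5 _∙_

data Tree : Set where
  nil : Tree
  _∙_ : Tree → Tree → Tree

size : Tree → ℕ
size nil     = 1
size (s ∙ t) = suc (size s + size t)

data Expr : Set where
  X     : Expr
  nil   : Expr
  cons  : Expr → Expr → Expr
  hd tl : Expr → Expr

eval : Expr → Tree → Tree
eval X          x = x
eval nil        x = nil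
eval (cons d e) x = eval d x ∙ eval e x
eval (hd e)     x with eval e x
... | nil   = nil
... | s ∙ t = s
eval (tl e)     x with eval e x
... | nil   = nil
... | s ∙ t = t

infixr 4 _⨟_

data Cmd : Set where
  X≔_           : Expr → Cmd
  _⨟_           : Cmd → Cmd → Cmd
  if_then_else_ : Expr → Cmd → Cmd → Cmd
  while_loop_   : Expr → Cmd → Cmd

-- Run c x y τ: started with X = x, the program c halts with X = y after
-- executing τ assignments and tests.  The expressions of a program are
-- fixed, and on trees stored as shared dags each of their operations
-- takes constant time.  So τ agrees with Turing machine time up to a
-- polynomial in τ, the size of the input and the size of the output; the
-- last has to be bounded separately, since a small dag can unfold to a
-- tree of exponential size.

data Run : Cmd → Tree → Tree → ℕ → Set where
  assign  : ∀ {e x} → Run (X≔ e) x (eval e x) 1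
  seq     : ∀ {c d x y z σ τ} →
            Run c x y σ → Run d y z τ → Run (c ⨟ d) x z (σ + τ)
  if-then : ∀ {e c d x y τ} → eval e x ≢ nil →
            Run c x y τ → Run (if e then c else d) x y (suc τ)
  if-else : ∀ {e c d x y τ} → eval e x ≡ nil →
            Run d x y τ → Run (if e then c else d) x y (suc τ)
  exit    : ∀ {e c x} → eval e x ≡ nil → Run (while e loop c) x x 1
  again   : ∀ {e c x y z σ τ} → eval e x ≢ nil →
            Run c x y σ → Run (while e loop c) y z τ →
            Run (while e loop c) x z (suc (σ + τ))

-- Numbers are coded in unary.

codeℕ : ℕ → Tree
codeℕ zero    = nil
codeℕ (suc n) = nil ∙ codeℕ n

codeBool : Bool → Tree
codeBool false = nil
codeBool true  = nil ∙ nil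

codeList : {A : Set} → (A → Tree) → List A → Tree
codeList code []       = nil
codeList code (a ∷ as) = code a ∙ codeList code as

Computable : (ℕ → ℕ) → Set
Computable f = ∃[ c ] (∀ n → ∃[ τ ] Run c (codeℕ n) (codeℕ (f n)) τ)

------------------------------------------------------------------------
-- Parameterized problems and FPT many-one reductions

-- A language L ⊆ Tree × ℕ is the problem with Input t k = ⊤ and
-- Yes t k = (t , k) ∈ L.  Problems whose inputs are required to be of a
-- certain form only pose the question for the pairs satisfying Input.

record ParamProblem : Set₁ where
  field
    Input : Tree → ℕ → Set
    Yes   : Tree → ℕ → Set

open ParamProblem

-- On (t , k) the program runs in time f(k)·|t|^d and outputs some
-- (t′ , k′) with |t′| ≤ f(k)·|t|^d and k′ ≤ g(k).  A polynomial in |t| is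
-- bounded by a constant times a power of |t|, as |t| ≥ 1, and f absorbs
-- the constant.

infix 3 _≤fpt_

record _≤fpt_ (P Q : ParamProblem) : Set where
  field
    program      : Cmd
    f g          : ℕ → ℕ
    d            : ℕ
    f-computable : Computable f
    g-computable : Computable g
    reduces      : ∀ t k → Input P t k →
      ∃[ t′ ] ∃[ k′ ] ∃[ τ ]
        Run program (t ∙ codeℕ k) (t′ ∙ codeℕ k′) τ ×
        τ ≤ f k * size t ^ d ×
        size t′ ≤ f k * size t ^ d ×
        k′ ≤ g k ×
        Input Q t′ k′ ×
        (Yes P t k ⇔ Yes Q t′ k′)

------------------------------------------------------------------------
-- Mini-3SAT

-- (b , x) is satisfied when the variable x has the value b.

Literal : Set
Literal = Bool × ℕ

Clause : Set
Clause = List Literal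

CNF : Set
CNF = List Clause

Is3CNF : CNF → Set
Is3CNF = All (λ C → length C ≤ 3)

-- The number of clauses plus the number of literal occurrences.

formulaSize : CNF → ℕ
formulaSize F = sum (map (suc ∘ length) F)

Satisfies : (ℕ → Bool) → CNF → Set
Satisfies α = All (Any (λ (b , x) → α x ≡ b))

codeLiteral : Literal → Tree
codeLiteral (b , x) = codeBool b ∙ codeℕ x

codeMini3SAT : ℕ → CNF → Tree
codeMini3SAT n F = codeℕ n ∙ codeList (codeList codeLiteral) F

-- The real inequality |F| ≤ k·log₂ n, exponentiated.

SizeBound : ℕ → ℕ → CNF → Set
SizeBound k n F = NonZero n × 2 ^ formulaSize F ≤ n ^ k

Mini3SAT : ParamProblem
Mini3SAT .Input t k =
  ∃[ n ] ∃[ F ] t ≡ codeMini3SAT n F × Is3CNF F × SizeBound k n F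
Mini3SAT .Yes t k =
  ∃[ n ] ∃[ F ] t ≡ codeMini3SAT n F × Is3CNF F × SizeBound k n F ×
                ∃[ α ] Satisfies α F

MINI[1] : ParamProblem → Set
MINI[1] P = P ≤fpt Mini3SAT

MINI[1]-hard : ParamProblem → Set₁
MINI[1]-hard Q = ∀ P → MINI[1] P → P ≤fpt Q

------------------------------------------------------------------------
-- Permutation groups given by generators

Generators : ℕ → Set
Generators n = List (Permutation′ n)

data Generated {n} (A : Generators n) : Permutation′ n → Set where
  gen  : ∀ {π} → π ∈ˡ A → Generated A π
  id   : Generated A Perm.id
  comp : ∀ {π ρ} → Generated A π → Generated A ρ → Generated A (π ∘ₚ ρ)
  inv  : ∀ {π} → Generated A π → Generated A (Perm.flip π)
  resp : ∀ {π ρ} → π ≈ ρ → Generated A π → Generated A ρ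

generatedGroup : ∀ {n} → Generators n → Group 0ℓ 0ℓ
generatedGroup {n} A = record
  { Carrier = Σ[ π ∈ Permutation′ n ] Generated A π
  ; _≈_     = λ (π , _) (ρ , _) → π ≈ ρ
  ; _∙_     = λ (π , p) (ρ , q) → π ∘ₚ ρ , comp p q
  ; ε       = Perm.id , id
  ; _⁻¹     = λ (π , p) → Perm.flip π , inv p
  ; isGroup = record
    { isMonoid = record
      { isSemigroup = record
        { isMagma = record
          { isEquivalence = record
            { refl  = λ _ → refl
            ; sym   = λ p i → sym (p i)
            ; trans = λ p q i → trans (p i) (q i)
            }
          ; ∙-cong = λ {_} {_} {_} {(σ , _)} p q i →
                       trans (q _) (cong (σ ⟨$⟩ʳ_) (p i))
          }
        ; assoc = λ _ _ _ _ → refl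
        }
      ; identity = (λ _ _ → refl) , (λ _ _ → refl)
      }
    ; inverse = (λ (π , _) _ → Perm.inverseʳ π) , (λ (π , _) _ → Perm.inverseˡ π)
    ; ⁻¹-cong = λ {(π , _)} {(ρ , _)} p i →
        trans (cong (π ⟨$⟩ˡ_)
                (sym (trans (p (ρ ⟨$⟩ˡ i)) (Perm.inverseʳ ρ))))
              (Perm.inverseˡ π)
    }
  }

-- ℤ/2 is the additive group of parities.

F₂^_ : ℕ → Group 0ℓ 0ℓ
F₂^ m = Pointwise.group (Fin m) +-0-group

infix 4 _≅_

_≅_ : Group 0ℓ 0ℓ → Group 0ℓ 0ℓ → Set
G ≅ H = Σ[ φ ∈ (Group.Carrier G → Group.Carrier H) ] IsGroupIsomorphism φ
  where open GroupMorphisms (Group.rawGroup G) (Group.rawGroup H)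

IsElementary2Group : Group 0ℓ 0ℓ → Set
IsElementary2Group G = ∃[ m ] G ≅ F₂^ m

------------------------------------------------------------------------
-- k-Base-Size

IsBase : ∀ {n} → Generators n → Subset n → Set
IsBase A S = ∀ π → Generated A π → (∀ i → i ∈ S → π ⟨$⟩ʳ i ≡ i) → π ≈ Perm.id

codePermutation : ∀ {n} → Permutation′ n → Tree
codePermutation π = codeList (codeℕ ∘ toℕ) (tabulate (π ⟨$⟩ʳ_))

codeGenerators : ∀ {n} → Generators n → Tree
codeGenerators {n} A = codeℕ n ∙ codeList codePermutation A

-- The inputs are the generating sets of groups in the class 𝒞.

BaseSizeOn : (Group 0ℓ 0ℓ → Set) → ParamProblem
BaseSizeOn 𝒞 .Input t k =
  ∃[ n ] Σ[ A ∈ Generators n ] t ≡ codeGenerators A × 𝒞 (generatedGroup A)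
BaseSizeOn 𝒞 .Yes t k =
  ∃[ n ] Σ[ A ∈ Generators n ] t ≡ codeGenerators A × 𝒞 (generatedGroup A) ×
                               ∃[ S ] ∣ S ∣ ≡ k × IsBase A S

BaseSize : ParamProblem
BaseSize = BaseSizeOn (λ _ → ⊤)

BaseSizeElementary2 : ParamProblem
BaseSizeElementary2 = BaseSizeOn IsElementary2Group

{-# OPTIONS --safe #-}
module Submission where

-- Split the literal occurrences of F into k blocks of ⌈L/k⌉ = O(log n) occurrences.  A block has O(n) assignments,
-- and each of them becomes an orbit on which F₂^m acts by translation through a coordinate projection; the kernel of
-- this action is the set of vectors vanishing on the labels of the orbit.  Hence a set of points is a base iff the
-- labels of the orbits it meets exhaust the m coordinates.  There is one coordinate for each block, which forces the
-- k base points to choose exactly one assignment for each block; one for each clause, covered by the occurrences that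
-- satisfy it; and one for each occurrence.  The occurrences of a variable are arranged in a cycle: an occurrence
-- covers its own coordinate when its variable is assigned false, and that of its successor when it is assigned true.
-- So all coordinates of the cycle are covered iff the assignments agree on the variable.
--
-- For a program in a first-order language whose only recursion is folding over lists, the running time is polynomial
-- in a common bound on the lengths of the lists that are folded over; this reduces all timing to list lengths.

open import Defs
open import Algebra.Bundles using (Group)
open import Data.Bool.Base using (Bool; true; false) renaming (if_then_else_ to ifᵇ_then_else_)
open import Data.Empty using (⊥-elim)
open import Data.Fin.Base using (Fin; toℕ; fromℕ<) renaming (zero to fzero; suc to fsuc)
open import Data.Fin.Permutation as Perm using (Permutation′; permutation; _≈_; _∘ₚ_; _⟨$⟩ʳ_; _⟨$⟩ˡ_)
import Data.Fin.Properties as Fin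
open import Data.Fin.Properties using (toℕ-fromℕ<; fromℕ<-toℕ; toℕ<n; toℕ-injective; any?)
open import Data.Fin.Subset using (Subset; ∣_∣; ⊥; inside; _-_) renaming (_∈_ to _∈ˢ_)
open import Data.Fin.Subset.Properties using (x∈p⇒∣p-x∣<∣p∣; x∈p∧x≢y⇒x∈p-y; ∣⊥∣≡0) renaming (_∈?_ to _∈ˢ?_)
open import Data.List.Base using (List; []; _∷_; length; foldr; map; _++_; _ʳ++_; reverse; downFrom; replicate; tabulate)
open import Data.List.Membership.Propositional using (_∈_; lose; find)
open import Data.List.Membership.Propositional.Properties using (∈-map⁺; ∈-map⁻; ∈-++⁺ˡ; ∈-++⁺ʳ; ∈-++⁻; ∈-downFrom⁺; ∈-downFrom⁻)
open import Data.List.Properties using (reverse-involutive; length-reverse; length-replicate; length-map; length-++; length-downFrom; length-tabulate; map-++; map-∘; map-id; map-cong; map-injective; map-tabulate; tabulate-cong; ++-assoc; ++-identityʳ; ∷-injectiveˡ; ∷-injectiveʳ)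
open import Data.List.Relation.Unary.All as All using (All; []; _∷_)
import Data.List.Relation.Unary.All.Properties as All
open import Data.List.Relation.Unary.AllPairs using (AllPairs; []; _∷_)
import Data.List.Relation.Unary.AllPairs.Properties as AllPairs
open import Data.List.Relation.Unary.Any as Any using (Any; here; there)
import Data.List.Relation.Unary.Any.Properties as Any
open import Data.Nat.Base using (ℕ; zero; suc; pred; _+_; _*_; _∸_; _^_; _≤_; _<_; z≤n; s≤s; s≤s⁻¹; NonZero; >-nonZero; >-nonZero⁻¹; _≡ᵇ_; ⌊_/2⌋; parity)
open import Data.Nat.Properties
open import Data.Nat.Tactic.RingSolver using (solve-∀)
open import Data.List.Membership.DecPropositional _≟_ using (_∈?_)
open import Data.Parity.Base using (Parity; 0ℙ; 1ℙ) renaming (_+_ to _⊕_)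
import Data.Parity.Properties as ℙ
open import Data.Product.Base using (Σ-syntax; ∃-syntax; _×_; _,_; proj₁; proj₂)
open import Data.Sum.Base using (_⊎_; inj₁; inj₂)
open import Data.Unit.Base using (⊤; tt)
import Data.Vec.Base as Vec
open import Function.Base using (_∘_; it)
open import Function.Bundles using (_⇔_; mk⇔)
open import Function.Construct.Composition using (_⇔-∘_)
open import Function.Construct.Symmetry using (⇔-sym)
open import Level using (0ℓ)
open import Relation.Binary.Definitions using (tri<; tri≈; tri>)
open import Relation.Binary.PropositionalEquality using (_≡_; _≢_; refl; sym; trans; cong; cong₂; subst)
open import Relation.Nullary.Decidable using (_×-dec_; dec-true; dec-false)
open import Relation.Nullary.Decidable.Core using (does; proof; yes; no)
open import Relation.Nullary.Negation using (¬_)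
open import Relation.Nullary.Reflects using (ofʸ; ofⁿ)

-- An occurrence may have to cover two labels at once, one on its cycle and one for its clause. With
-- a label for the block, an assignment of `s` occurrences thus carries `2 * s + 1` labels and
-- becomes a row of `2 ^ (2 * s + 1)` points; since `2 ^ s ≤ 2 * n`, this is still quadratic in `n`.
-- All rows are given the same number of labels, by repeating labels where fewer are wanted, so that
-- a point is a plain number: its low bits are coordinates and the rest is the number of its row. A
-- repeated label splits a row into several orbits, but all its points keep the same stabilizer, and
-- only stabilizers matter for bases. The block labels lie below `k` and occur in no other block;
-- this is why `k` points covering all of them must be one from each block. For the group to be all
-- of F₂^m, and for an uncovered label to yield a nontrivial element, every label has to occur
-- somewhere. This is arranged by giving a block of its own to every label below `m`; from `k` on
-- the occurrences are used up, and the rows of such a block carry only its own label. A base of `k`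
-- points has no point to spare for them.

-- Evaluation and local stores in the WHILE language

hdᵗ tlᵗ : Tree → Tree
hdᵗ nil     = nil
hdᵗ (s ∙ t) = s
tlᵗ nil     = nil
tlᵗ (s ∙ t) = t

eval-hd : ∀ e x → eval (hd e) x ≡ hdᵗ (eval e x)
eval-hd e x with eval e x
... | nil   = refl
... | s ∙ t = refl

eval-tl : ∀ e x → eval (tl e) x ≡ tlᵗ (eval e x)
eval-tl e x with eval e x
... | nil   = refl
... | s ∙ t = refl

_[_] : Expr → Expr → Expr
X        [ d ] = d
nil      [ d ] = nil
cons e f [ d ] = cons (e [ d ]) (f [ d ])
hd e     [ d ] = hd (e [ d ])
tl e     [ d ] = tl (e [ d ])

eval-[] : ∀ e d x → eval (e [ d ]) x ≡ eval e (eval d x)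
eval-[] X          d x = refl
eval-[] nil        d x = refl
eval-[] (cons e f) d x = cong₂ _∙_ (eval-[] e d x) (eval-[] f d x)
eval-[] (hd e)     d x = trans (eval-hd (e [ d ]) x)
  (trans (cong hdᵗ (eval-[] e d x)) (sym (eval-hd e _)))
eval-[] (tl e)     d x = trans (eval-tl (e [ d ]) x)
  (trans (cong tlᵗ (eval-[] e d x)) (sym (eval-tl e _)))

-- With a single variable, a value is saved by pairing: `frame c` works on the head of the store and
-- leaves the tail alone, taking exactly as many steps as `c`.
frame : Cmd → Cmd
frame (X≔ e)               = X≔ cons (e [ hd X ]) (tl X)
frame (c ⨟ d)              = frame c ⨟ frame d
frame (if e then c else d) = if e [ hd X ] then frame c else frame d
frame (while e loop c)     = while e [ hd X ] loop frame c

run-frame : ∀ {c x y τ} z → Run c x y τ → Run (frame c) (x ∙ z) (y ∙ z) τ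
run-frame {X≔ e} {x} z assign =
  subst (λ y → Run (frame (X≔ e)) (x ∙ z) (y ∙ z) 1) (eval-[] e (hd X) (x ∙ z)) assign
run-frame z (seq p q)               = seq (run-frame z p) (run-frame z q)
run-frame z (if-then {e} e≢nil p)   =
  if-then (λ q → e≢nil (trans (sym (eval-[] e (hd X) _)) q)) (run-frame z p)
run-frame z (if-else {e} e≡nil p)   =
  if-else (trans (eval-[] e (hd X) _) e≡nil) (run-frame z p)
run-frame z (exit {e} e≡nil)        = exit (trans (eval-[] e (hd X) _) e≡nil)
run-frame z (again {e} e≢nil p q)   =
  again (λ r → e≢nil (trans (sym (eval-[] e (hd X) _)) r)) (run-frame z p) (run-frame z q)

-- A total first-order language

infixr 6 _⊗_

data Ty : Set where
  nat bool : Ty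
  list     : Ty → Ty
  _⊗_      : Ty → Ty → Ty

⟦_⟧ᵗ : Ty → Set
⟦ nat ⟧ᵗ    = ℕ
⟦ bool ⟧ᵗ   = Bool
⟦ list A ⟧ᵗ = List ⟦ A ⟧ᵗ
⟦ A ⊗ B ⟧ᵗ  = ⟦ A ⟧ᵗ × ⟦ B ⟧ᵗ

code : ∀ A → ⟦ A ⟧ᵗ → Tree
code nat      = codeℕ
code bool     = codeBool
code (list A) = codeList (code A)
code (A ⊗ B) (a , b) = code A a ∙ code B b

∙-injective : ∀ {s t s′ t′} → s ∙ t ≡ s′ ∙ t′ → s ≡ s′ × t ≡ t′
∙-injective refl = refl , refl

-- `Yes` quantifies afresh over the objects coded by a tree; injectivity identifies them with the
-- given ones.
code-injective : ∀ A {a b} → code A a ≡ code A b → a ≡ b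
code-injective nat {zero}  {zero}  p = refl
code-injective nat {suc a} {suc b} p = cong suc (code-injective nat (proj₂ (∙-injective p)))
code-injective bool {false} {false} p = refl
code-injective bool {true}  {true}  p = refl
code-injective (list A) {[]}     {[]}     p = refl
code-injective (list A) {a ∷ as} {b ∷ bs} p =
  cong₂ _∷_ (code-injective A (proj₁ (∙-injective p)))
            (code-injective (list A) (proj₂ (∙-injective p)))
code-injective (A ⊗ B) p =
  cong₂ _,_ (code-injective A (proj₁ (∙-injective p))) (code-injective B (proj₂ (∙-injective p)))

data Ex (A : Ty) : Ty → Set where
  var              : Ex A A
  fst              : ∀ {B C} → Ex A (B ⊗ C) → Ex A B
  snd              : ∀ {B C} → Ex A (B ⊗ C) → Ex A C
  pair             : ∀ {B C} → Ex A B → Ex A C → Ex A (B ⊗ C)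
  nilₑ             : ∀ {B} → Ex A (list B)
  consₑ            : ∀ {B} → Ex A B → Ex A (list B) → Ex A (list B)
  tailₑ            : ∀ {B} → Ex A (list B) → Ex A (list B)
  trueₑ falseₑ     : Ex A bool
  zeroₑ            : Ex A nat
  sucₑ predₑ       : Ex A nat → Ex A nat
  unary            : Ex A nat → Ex A (list bool)

tailₗ : ∀ {A : Set} → List A → List A
tailₗ []       = []
tailₗ (_ ∷ as) = as

⟦_⟧ᵉ : ∀ {A B} → Ex A B → ⟦ A ⟧ᵗ → ⟦ B ⟧ᵗ
⟦ var ⟧ᵉ       a = a
⟦ fst e ⟧ᵉ     a = proj₁ (⟦ e ⟧ᵉ a)
⟦ snd e ⟧ᵉ     a = proj₂ (⟦ e ⟧ᵉ a)
⟦ pair e f ⟧ᵉ  a = ⟦ e ⟧ᵉ a , ⟦ f ⟧ᵉ a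
⟦ nilₑ ⟧ᵉ      a = []
⟦ consₑ e f ⟧ᵉ a = ⟦ e ⟧ᵉ a ∷ ⟦ f ⟧ᵉ a
⟦ tailₑ e ⟧ᵉ   a = tailₗ (⟦ e ⟧ᵉ a)
⟦ trueₑ ⟧ᵉ     a = true
⟦ falseₑ ⟧ᵉ    a = false
⟦ zeroₑ ⟧ᵉ     a = zero
⟦ sucₑ e ⟧ᵉ    a = suc (⟦ e ⟧ᵉ a)
⟦ predₑ e ⟧ᵉ   a = pred (⟦ e ⟧ᵉ a)
⟦ unary e ⟧ᵉ   a = replicate (⟦ e ⟧ᵉ a) false

compileₑ : ∀ {A B} → Ex A B → Expr
compileₑ var         = X
compileₑ (fst e)     = hd (compileₑ e)
compileₑ (snd e)     = tl (compileₑ e)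
compileₑ (pair e f)  = cons (compileₑ e) (compileₑ f)
compileₑ nilₑ        = nil
compileₑ (consₑ e f) = cons (compileₑ e) (compileₑ f)
compileₑ (tailₑ e)   = tl (compileₑ e)
compileₑ trueₑ       = cons nil nil
compileₑ falseₑ      = nil
compileₑ zeroₑ       = nil
compileₑ (sucₑ e)    = cons nil (compileₑ e)
compileₑ (predₑ e)   = tl (compileₑ e)
compileₑ (unary e)   = compileₑ e

tlᵗ-codeℕ : ∀ n → tlᵗ (codeℕ n) ≡ codeℕ (pred n)
tlᵗ-codeℕ zero    = refl
tlᵗ-codeℕ (suc n) = refl

tlᵗ-codeList : ∀ {A : Set} (c : A → Tree) as → tlᵗ (codeList c as) ≡ codeList c (tailₗ as)
tlᵗ-codeList c []       = refl
tlᵗ-codeList c (a ∷ as) = refl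

-- The two codes are the same tree, so the conversion `unary` is free and counting loops become
-- folds over lists.
code-unary : ∀ n → codeℕ n ≡ codeList codeBool (replicate n false)
code-unary zero    = refl
code-unary (suc n) = cong (nil ∙_) (code-unary n)

eval-compileₑ : ∀ {A B} (e : Ex A B) a → eval (compileₑ e) (code A a) ≡ code B (⟦ e ⟧ᵉ a)
eval-compileₑ var a = refl
eval-compileₑ {A} (fst e) a =
  trans (eval-hd (compileₑ e) (code A a)) (cong hdᵗ (eval-compileₑ e a))
eval-compileₑ {A} (snd e) a =
  trans (eval-tl (compileₑ e) (code A a)) (cong tlᵗ (eval-compileₑ e a))
eval-compileₑ (pair e f) a = cong₂ _∙_ (eval-compileₑ e a) (eval-compileₑ f a)
eval-compileₑ nilₑ a = refl
eval-compileₑ (consₑ e f) a = cong₂ _∙_ (eval-compileₑ e a) (eval-compileₑ f a)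
eval-compileₑ {A} (tailₑ e) a =
  trans (eval-tl (compileₑ e) (code A a))
    (trans (cong tlᵗ (eval-compileₑ e a)) (tlᵗ-codeList _ (⟦ e ⟧ᵉ a)))
eval-compileₑ trueₑ a = refl
eval-compileₑ falseₑ a = refl
eval-compileₑ zeroₑ a = refl
eval-compileₑ (sucₑ e) a = cong (nil ∙_) (eval-compileₑ e a)
eval-compileₑ {A} (predₑ e) a =
  trans (eval-tl (compileₑ e) (code A a))
    (trans (cong tlᵗ (eval-compileₑ e a)) (tlᵗ-codeℕ (⟦ e ⟧ᵉ a)))
eval-compileₑ (unary e) a = trans (eval-compileₑ e a) (code-unary (⟦ e ⟧ᵉ a))

-- Programs, their compilation and their running time

infixr 5 _⟫_

data Fn : Ty → Ty → Set where
  expr : ∀ {A B} → Ex A B → Fn A B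
  _⟫_  : ∀ {A B C} → Fn A B → Fn B C → Fn A C
  bind : ∀ {A B C} → Fn A B → Fn (B ⊗ A) C → Fn A C
  ite  : ∀ {A B} → Ex A bool → Fn A B → Fn A B → Fn A B
  fold : ∀ {G A S} → Fn (G ⊗ (A ⊗ S)) S → Fn (G ⊗ (list A ⊗ S)) S

⟦_⟧ : ∀ {A B} → Fn A B → ⟦ A ⟧ᵗ → ⟦ B ⟧ᵗ
⟦ expr e ⟧    a = ⟦ e ⟧ᵉ a
⟦ f ⟫ g ⟧     a = ⟦ g ⟧ (⟦ f ⟧ a)
⟦ bind f g ⟧  a = ⟦ g ⟧ (⟦ f ⟧ a , a)
⟦ ite e f g ⟧ a = ifᵇ ⟦ e ⟧ᵉ a then ⟦ f ⟧ a else ⟦ g ⟧ a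
⟦ fold f ⟧ (c , as , s) = foldr (λ a s → ⟦ f ⟧ (c , a , s)) s as

-- `fold` is a right fold, while a loop consumes a list from its front. Hence the list is first
-- reversed, in a store of the form `rest ∙ (reversed ∙ (c ∙ s))`. The main loop has the store
-- `rest ∙ (c ∙ s)`; its body runs under `frame` on `c ∙ (a ∙ s)`, with `rest ∙ c` saved.
rev-init rev-body fold-pre fold-post : Expr
rev-init  = cons (hd (tl X)) (cons nil (cons (hd X) (tl (tl X))))
rev-body  = cons (tl (hd X)) (cons (cons (hd (hd X)) (hd (tl X))) (tl (tl X)))
fold-pre  = cons (cons (hd (tl X)) (cons (hd (hd X)) (tl (tl X)))) (cons (tl (hd X)) (hd (tl X)))
fold-post = cons (hd (tl X)) (cons (tl (tl X)) (hd X))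

rev-loop : Cmd
rev-loop = while hd X loop X≔ rev-body

fold-loop : Cmd → Cmd
fold-loop c = while hd X loop (X≔ fold-pre ⨟ frame c ⨟ X≔ fold-post)

compile : ∀ {A B} → Fn A B → Cmd
compile (expr e)    = X≔ compileₑ e
compile (f ⟫ g)     = compile f ⨟ compile g
compile (bind f g)  = X≔ cons X X ⨟ frame (compile f) ⨟ compile g
compile (ite e f g) = if compileₑ e then compile f else compile g
compile (fold f)    =
  X≔ rev-init ⨟ rev-loop ⨟ X≔ tl X ⨟ fold-loop (compile f) ⨟ X≔ tl (tl X)

-- Short M f a: in the evaluation of f at a every folded list has length at most M.

mutual
  Short : ∀ {A B} → ℕ → Fn A B → ⟦ A ⟧ᵗ → Set
  Short M (expr e)    a = ⊤
  Short M (f ⟫ g)     a = Short M f a × Short M g (⟦ f ⟧ a)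
  Short M (bind f g)  a = Short M f a × Short M g (⟦ f ⟧ a , a)
  Short M (ite e f g) a = ifᵇ ⟦ e ⟧ᵉ a then Short M f a else Short M g a
  Short M (fold f) (c , as , s) = length as ≤ M × ShortFold M f c as s

  ShortFold : ∀ {G A S} → ℕ → Fn (G ⊗ (A ⊗ S)) S → ⟦ G ⟧ᵗ → List ⟦ A ⟧ᵗ → ⟦ S ⟧ᵗ → Set
  ShortFold M f c []       s = ⊤
  ShortFold M f c (a ∷ as) s = ShortFold M f c as s × Short M f (c , a , ⟦ fold f ⟧ (c , as , s))

-- The evaluation of f takes time at most coeff f · (1 + M) ^ deg f.

coeff deg : ∀ {A B} → Fn A B → ℕ
coeff (expr e)    = 1
coeff (f ⟫ g)     = coeff f + coeff g
coeff (bind f g)  = 1 + (coeff f + coeff g)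
coeff (ite e f g) = 1 + (coeff f + coeff g)
coeff (fold f)    = coeff f + 5
deg (expr e)    = 0
deg (f ⟫ g)     = deg f + deg g
deg (bind f g)  = deg f + deg g
deg (ite e f g) = deg f + deg g
deg (fold f)    = suc (deg f)

cost : ∀ {A B} → ℕ → Fn A B → ℕ
cost M f = coeff f * suc M ^ deg f

Runs : Cmd → Tree → Tree → ℕ → Set
Runs c x y b = ∃[ τ ] Run c x y τ × τ ≤ b

runs-≤ : ∀ {c x y b b′} → b ≤ b′ → Runs c x y b → Runs c x y b′
runs-≤ b≤b′ (τ , r , p) = τ , r , ≤-trans p b≤b′

runs-seq : ∀ {c d x y z b b′} → Runs c x y b → Runs d y z b′ → Runs (c ⨟ d) x z (b + b′)
runs-seq (_ , p , p≤) (_ , q , q≤) = _ , seq p q , +-mono-≤ p≤ q≤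

runs-assign : ∀ {e x y} → eval e x ≡ y → Runs (X≔ e) x y 1
runs-assign refl = 1 , assign , ≤-refl

runs-frame : ∀ {c x y b} z → Runs c x y b → Runs (frame c) (x ∙ z) (y ∙ z) b
runs-frame z (_ , p , p≤) = _ , run-frame z p , p≤

codeBool-true≢nil : codeBool true ≢ nil
codeBool-true≢nil ()

1≤suc^ : ∀ M d → 1 ≤ suc M ^ d
1≤suc^ M d = m^n>0 (suc M) d

^-+-≤ : ∀ x .{{_ : NonZero x}} a b d e → a * x ^ d + b * x ^ e ≤ (a + b) * x ^ (d + e)
^-+-≤ x a b d e = begin
  a * x ^ d + b * x ^ e
    ≤⟨ +-mono-≤ (*-monoʳ-≤ a (^-monoʳ-≤ x (m≤m+n d e))) (*-monoʳ-≤ b (^-monoʳ-≤ x (m≤n+m e d))) ⟩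
  a * x ^ (d + e) + b * x ^ (d + e)
    ≡⟨ sym (*-distribʳ-+ (x ^ (d + e)) a b) ⟩
  (a + b) * x ^ (d + e) ∎
  where open ≤-Reasoning

cost-1+ : ∀ M a b d e → 1 + (a * suc M ^ d + b * suc M ^ e) ≤ (1 + (a + b)) * suc M ^ (d + e)
cost-1+ M a b d e = +-mono-≤ (1≤suc^ M (d + e)) (^-+-≤ (suc M) a b d e)

-- The left side follows the compiled fold: initialisation, reversal with two steps for each
-- element, removal of the emptied list, the main loop with three steps besides the body, and the
-- final projection.
cost-fold : ∀ M a d n → n ≤ M →
            1 + (n * 2 + 1 + (1 + (n * (a * suc M ^ d + 3) + 1 + 1))) ≤ (a + 5) * (suc M * suc M ^ d)
cost-fold M a d n n≤M = begin
  1 + (n * 2 + 1 + (1 + (n * (a * P + 3) + 1 + 1)))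
    ≤⟨ s≤s (+-mono-≤ (+-monoˡ-≤ 1 (*-monoˡ-≤ 2 n≤M))
         (s≤s (+-monoˡ-≤ 1 (+-monoˡ-≤ 1 (*-monoˡ-≤ (a * P + 3) n≤M))))) ⟩
  1 + (M * 2 + 1 + (1 + (M * (a * P + 3) + 1 + 1)))
    -- The summand `a * P` completes `M` to `suc M` in the leading term.
    ≤⟨ m≤m+n _ (a * P) ⟩
  1 + (M * 2 + 1 + (1 + (M * (a * P + 3) + 1 + 1))) + a * P
    ≡⟨ lem M a P ⟩
  a * (suc M * P) + 5 * (suc M * 1)
    ≤⟨ +-monoʳ-≤ (a * (suc M * P)) (*-monoʳ-≤ 5 (*-monoʳ-≤ (suc M) (1≤suc^ M d))) ⟩
  a * (suc M * P) + 5 * (suc M * P)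
    ≡⟨ sym (*-distribʳ-+ (suc M * P) a 5) ⟩
  (a + 5) * (suc M * P) ∎
  where
  open ≤-Reasoning
  P = suc M ^ d
  lem : ∀ M a P → 1 + (M * 2 + 1 + (1 + (M * (a * P + 3) + 1 + 1))) + a * P ≡
                  a * (suc M * P) + 5 * (suc M * 1)
  lem = solve-∀

rev-loop-runs : ∀ {A : Set} (c : A → Tree) as bs z →
  Runs rev-loop (codeList c as ∙ (codeList c bs ∙ z)) (nil ∙ (codeList c (as ʳ++ bs) ∙ z))
       (length as * 2 + 1)
rev-loop-runs c []       bs z = 1 , exit refl , ≤-refl
rev-loop-runs c (a ∷ as) bs z with rev-loop-runs c as (a ∷ bs) z
... | τ , r , τ≤ = suc (1 + τ) , again (λ ()) assign r , s≤s (s≤s τ≤)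

short-drop : ∀ {G A S M} (f : Fn (G ⊗ (A ⊗ S)) S) {c} rs {as s} →
             ShortFold M f c (rs ʳ++ as) s → ShortFold M f c as s
short-drop f []       p = p
short-drop f (r ∷ rs) p = proj₁ (short-drop f rs p)

-- The loop invariant: `rs` is what remains to be consumed, in reverse order, and the accumulator is
-- the fold over the suffix `as` consumed so far.
fold-loop-runs : ∀ {G A S} M (f : Fn (G ⊗ (A ⊗ S)) S) b →
  (∀ a → Short M f a → Runs (compile f) (code _ a) (code _ (⟦ f ⟧ a)) b) →
  ∀ c rs as s → ShortFold M f c (rs ʳ++ as) s →
  Runs (fold-loop (compile f))
       (code (list A) rs ∙ (code G c ∙ code S (⟦ fold f ⟧ (c , as , s))))
       (nil ∙ (code G c ∙ code S (⟦ fold f ⟧ (c , rs ʳ++ as , s))))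
       (length rs * (b + 3) + 1)
fold-loop-runs M f b body c []       as s p = 1 , exit refl , ≤-refl
fold-loop-runs M f b body c (r ∷ rs) as s p
  with body _ (proj₂ (short-drop f rs p)) | fold-loop-runs M f b body c rs (r ∷ as) s p
... | σ , q , σ≤ | τ , q′ , τ≤ =
  suc (1 + (σ + 1) + τ) , again (λ ()) (seq assign (seq (run-frame _ q) assign)) q′ , bound
  where
  open ≤-Reasoning
  bound : suc (1 + (σ + 1) + τ) ≤ (b + 3) + length rs * (b + 3) + 1
  bound = begin
    suc (1 + (σ + 1) + τ)                           ≤⟨ s≤s (s≤s (+-mono-≤ (+-monoˡ-≤ 1 σ≤) τ≤)) ⟩
    2 + ((b + 1) + (length rs * (b + 3) + 1))       ≡⟨ lem b (length rs * (b + 3)) ⟩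
    (b + 3) + length rs * (b + 3) + 1               ∎
    where
    lem : ∀ b n → 2 + ((b + 1) + (n + 1)) ≡ (b + 3) + n + 1
    lem = solve-∀

compile-runs : ∀ {A B} M (f : Fn A B) a → Short M f a →
               Runs (compile f) (code A a) (code B (⟦ f ⟧ a)) (cost M f)
compile-runs M (expr e) a p = runs-assign (eval-compileₑ e a)
compile-runs M (f ⟫ g) a (p , q) =
  runs-≤ (^-+-≤ (suc M) (coeff f) (coeff g) (deg f) (deg g))
    (runs-seq (compile-runs M f a p) (compile-runs M g _ q))
compile-runs {A} M (bind f g) a (p , q) =
  runs-≤ (cost-1+ M (coeff f) (coeff g) (deg f) (deg g))
    (runs-seq (runs-assign refl)
      (runs-seq (runs-frame (code A a) (compile-runs M f a p)) (compile-runs M g _ q)))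
compile-runs {A} M (ite e f g) a p with ⟦ e ⟧ᵉ a | eval-compileₑ e a
... | true | eq with compile-runs M f a p
... | τ , r , τ≤ = suc τ , if-then (λ n → codeBool-true≢nil (trans (sym eq) n)) r ,
  ≤-trans (s≤s (≤-trans τ≤ (m≤m+n _ _))) (cost-1+ M (coeff f) (coeff g) (deg f) (deg g))
compile-runs {A} M (ite e f g) a p | false | eq with compile-runs M g a p
... | τ , r , τ≤ = suc τ , if-else eq r ,
  ≤-trans (s≤s (≤-trans τ≤ (m≤n+m _ _))) (cost-1+ M (coeff f) (coeff g) (deg f) (deg g))
compile-runs {G ⊗ (list A ⊗ S)} M (fold f) (c , as , s) (n≤M , p) =
  runs-≤ (subst (λ n → 1 + (length as * 2 + 1 + (1 + (n * (cost M f + 3) + 1 + 1))) ≤ cost M (fold f))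
           (sym (length-reverse as)) (cost-fold M (coeff f) (deg f) (length as) n≤M))
    (runs-seq (runs-assign refl)
      (runs-seq (rev-loop-runs (code A) as [] (code G c ∙ code S s))
        (runs-seq (runs-assign refl)
          (runs-seq
            (fold-loop-runs M f (cost M f) (λ a q → compile-runs M f a q) c (reverse as) [] s
              (subst (λ l → ShortFold M f c l s) (sym (reverse-involutive as)) p))
            (runs-assign
              (cong (λ l → code S (⟦ fold f ⟧ (c , l , s))) (reverse-involutive as)))))))

-- The reduction as a program

literal slot decorated row : Ty
literal   = bool ⊗ nat
-- ((b , x) , (p , h)): an occurrence with number p of the literal (b , x) in the clause with number h
slot      = literal ⊗ (nat ⊗ nat)
-- the labels covered by a slot if its variable is false and if it is true
decorated = (nat ⊗ nat) ⊗ (nat ⊗ nat)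
row       = list nat

monus : Fn (nat ⊗ nat) nat
monus = expr (pair var (pair (unary (fst var)) (snd var))) ⟫ fold (expr (predₑ (snd (snd var))))

isZero : Fn nat bool
isZero = expr (pair var (pair (unary var) trueₑ)) ⟫ fold (expr falseₑ)

equal : Fn (nat ⊗ nat) bool
equal = bind (monus ⟫ isZero)
  (ite (fst var)
    (expr (pair (snd (snd var)) (fst (snd var))) ⟫ monus ⟫ isZero)
    (expr falseₑ))

append : ∀ {A} → Fn (list A ⊗ list A) (list A)
append = expr (pair var var) ⟫ fold (expr (consₑ (fst (snd var)) (snd (snd var))))

headOr : ∀ {A} → Fn (A ⊗ list A) A
headOr = expr (pair (fst var) (pair (snd var) (fst var))) ⟫ fold (expr (fst (snd var)))

double : Fn nat nat
double = expr (pair var (pair (unary var) zeroₑ)) ⟫ fold (expr (sucₑ (sucₑ (snd (snd var)))))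

len : ∀ {A} → Fn (list A) nat
len = expr (pair var (pair var zeroₑ)) ⟫ fold (expr (sucₑ (snd (snd var))))

countdown : Fn nat (list nat)
countdown =
  (expr (pair var (pair (unary var) (pair zeroₑ nilₑ))) ⟫
   fold (expr (pair (sucₑ (fst (snd (snd var)))) (consₑ (fst (snd (snd var))) (snd (snd (snd var)))))))
  ⟫ expr (snd var)

-- ((x , d) , W) ↦ the number of the first slot with variable x in W, or d if there is none
findSlot : Fn ((nat ⊗ nat) ⊗ list slot) nat
findSlot = expr (pair (fst (fst var)) (pair (snd var) (snd (fst var)))) ⟫
  fold (bind (expr (pair (fst var) (snd (fst (fst (snd var))))) ⟫ equal)
    (ite (fst var) (expr (fst (snd (fst (snd (snd var)))))) (expr (snd (snd (snd var))))))

flattenClause : Fn (nat ⊗ (list literal ⊗ (nat ⊗ list slot))) (nat ⊗ list slot)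
flattenClause = fold (expr
  (pair (sucₑ (fst (snd (snd var))))
        (consₑ (pair (fst (snd var)) (pair (fst (snd (snd var))) (fst var))) (snd (snd (snd var))))))

-- Counting starts at `k` because smaller labels belong to the blocks. A clause takes the current
-- number as its header and its occurrences take the numbers after it. As folds run from the right,
-- numbers decrease along the resulting list.
flatten : Fn (list (list literal) ⊗ nat) (nat ⊗ list slot)
flatten = expr (pair var (pair (fst var) (pair (snd var) nilₑ))) ⟫
  fold (expr (pair (fst (snd (snd var)))
               (pair (fst (snd var)) (pair (sucₑ (fst (snd (snd var)))) (snd (snd (snd var))))))
        ⟫ flattenClause)

-- (W , (w , (rest , acc))) ↦ the number of the next slot with the variable of w, cyclically
next : Fn (list slot ⊗ (slot ⊗ (list slot ⊗ list decorated))) nat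
next = bind (expr (pair (pair (snd (fst (fst (snd var)))) (fst (snd (fst (snd var))))) (fst var)) ⟫ findSlot)
  (expr (pair (pair (snd (fst (fst (snd (snd var))))) (fst var)) (fst (snd (snd (snd var))))) ⟫ findSlot)

-- Where the literal is not satisfied, the label on the cycle is repeated in place of the header, so
-- that either value contributes exactly two labels.
labels : Fn (slot ⊗ nat) decorated
labels = ite (fst (fst (fst var)))
  (expr (pair (pair (fst (snd (fst var))) (fst (snd (fst var))))
              (pair (snd var) (snd (snd (fst var))))))
  (expr (pair (pair (fst (snd (fst var))) (snd (snd (fst var))))
              (pair (snd var) (snd var))))

-- The body of a fold does not see the tail of its list, so the state rebuilds this tail for `next`
-- to search.
decorateStep : Fn (list slot ⊗ (slot ⊗ (list slot ⊗ list decorated))) (list slot ⊗ list decorated)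
decorateStep = bind (bind next (expr (pair (fst (snd (snd var))) (fst var)) ⟫ labels))
  (expr (pair (consₑ (fst (snd (snd var))) (fst (snd (snd (snd var)))))
              (consₑ (fst var) (snd (snd (snd (snd var)))))))

decorate : Fn (list slot) (list decorated)
decorate = (expr (pair var (pair var (pair nilₑ nilₑ))) ⟫ fold decorateStep) ⟫ expr (snd var)

-- (k , W) ↦ ⌈ length W / k ⌉
quotientStep : Fn (nat ⊗ (slot ⊗ (nat ⊗ nat))) (nat ⊗ nat)
quotientStep = bind (expr (snd (snd (snd var))) ⟫ isZero)
  (ite (fst var)
    (expr (pair (sucₑ (fst (snd (snd (snd var))))) (predₑ (fst (snd var)))))
    (expr (pair (fst (snd (snd (snd var)))) (predₑ (snd (snd (snd (snd var))))))))

quotient : Fn (nat ⊗ list slot) nat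
quotient = (expr (pair (fst var) (pair (snd var) (pair zeroₑ zeroₑ))) ⟫ fold quotientStep) ⟫ expr (fst var)

extend : Fn (decorated ⊗ list row) (list row)
extend = expr (pair (fst var) (pair (snd var) nilₑ)) ⟫
  fold (expr (consₑ (consₑ (fst (fst (fst var))) (consₑ (snd (fst (fst var))) (fst (snd var))))
             (consₑ (consₑ (fst (snd (fst var))) (consₑ (snd (snd (fst var))) (fst (snd var))))
                    (snd (snd var)))))

-- When the occurrences are used up, `headOr` supplies one whose four labels are all the label of
-- the block, which keeps the row length uniform.
pieceStep : Fn (nat ⊗ (bool ⊗ (list decorated ⊗ list row))) (list decorated ⊗ list row)
pieceStep =
  bind (expr (pair (pair (pair (fst var) (fst var)) (pair (fst var) (fst var))) (fst (snd (snd var)))) ⟫ headOr)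
  (bind (expr (pair (fst var) (snd (snd (snd (snd var))))) ⟫ extend)
    (expr (pair (tailₑ (fst (snd (snd (snd (snd var)))))) (fst var))))

piece : Fn (nat ⊗ (nat ⊗ list decorated)) (list decorated ⊗ list row)
piece = expr (pair (fst (snd var))
               (pair (unary (fst var)) (pair (snd (snd var)) (consₑ (consₑ (fst (snd var)) nilₑ) nilₑ))))
  ⟫ fold pieceStep

piecesStep : Fn (nat ⊗ (nat ⊗ (list decorated ⊗ list row))) (list decorated ⊗ list row)
piecesStep =
  bind (expr (pair (fst var) (pair (fst (snd var)) (fst (snd (snd var))))) ⟫ piece)
  (bind (expr (pair (snd (fst var)) (snd (snd (snd (snd var))))) ⟫ append)
    (expr (pair (fst (fst (snd var))) (fst var))))

-- In the reduction the list of block labels is all of `downFrom m`, not just the labels below `k`: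
-- the blocks from `k` on get no occurrences and serve only to make every label occur. Label 0 is
-- met first, so block 0 takes the first `s` occurrences.
pieces : Fn (nat ⊗ (list nat ⊗ list decorated)) (list decorated ⊗ list row)
pieces = expr (pair (fst var) (pair (fst (snd var)) (pair (snd (snd var)) nilₑ))) ⟫ fold piecesStep

-- Every point gets a new lowest bit; the order of the two refinements is swapped when the generator
-- flips that bit.
splitPoint : Fn (bool ⊗ (nat ⊗ list nat)) (list nat)
splitPoint = bind (expr (fst (snd var)) ⟫ double)
  (ite (fst (snd var))
    (expr (consₑ (sucₑ (fst var)) (consₑ (fst var) (snd (snd (snd var))))))
    (expr (consₑ (fst var) (consₑ (sucₑ (fst var)) (snd (snd (snd var)))))))

expandStep : Fn (nat ⊗ (nat ⊗ list nat)) (list nat)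
expandStep = bind (expr (pair (fst var) (fst (snd var))) ⟫ equal)
  (expr (pair (fst var) (pair (snd (snd (snd var))) nilₑ)) ⟫ fold splitPoint)

-- (u , (ℓs , i)) ↦ the images of the points of the i-th row, with labels ℓs, under the generator u
expand : Fn (nat ⊗ (row ⊗ nat)) (list nat)
expand = expr (pair (fst var) (pair (fst (snd var)) (consₑ (snd (snd var)) nilₑ))) ⟫ fold expandStep

tableStep : Fn (nat ⊗ (row ⊗ (nat ⊗ list nat))) (nat ⊗ list nat)
tableStep =
  bind (expr (pair (fst var) (pair (fst (snd var)) (fst (snd (snd var))))) ⟫ expand)
  (bind (expr (pair (snd (snd (snd (snd var)))) (fst var)) ⟫ append)
    (expr (pair (sucₑ (fst (snd (snd (snd (snd var)))))) (fst var))))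

table : Fn (nat ⊗ list row) (list nat)
table = (expr (pair (fst var) (pair (snd var) (pair zeroₑ nilₑ))) ⟫ fold tableStep) ⟫ expr (snd var)

tables : Fn (list nat ⊗ list row) (list (list nat))
tables = expr (pair (snd var) (pair (fst var) nilₑ)) ⟫
  fold (bind (expr (pair (fst (snd var)) (fst var)) ⟫ table)
    (expr (consₑ (fst var) (snd (snd (snd var))))))

-- (k , (m , W)) ↦ (the labels below m , the rows)
coverRows : Fn (nat ⊗ (nat ⊗ list slot)) (list nat ⊗ list row)
coverRows = bind (expr (snd (snd var)) ⟫ decorate)
  (bind (expr (pair (fst (snd var)) (snd (snd (snd var)))) ⟫ quotient)
    (bind (expr (fst (snd (snd (snd var)))) ⟫ countdown)
      (bind (expr (pair (fst (snd var)) (pair (fst var) (fst (snd (snd var))))) ⟫ pieces)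
        (expr (pair (fst (snd var)) (snd (fst var)))))))

-- The number of points is read off as the length of a table, which is the same for every label, in
-- place of computing a product of powers.
emit : Fn (list nat ⊗ list row) (nat ⊗ list (list nat))
emit = bind (expr (pair zeroₑ (snd var)) ⟫ table ⟫ len)
  (bind (expr (snd var) ⟫ tables)
    (expr (pair (fst (snd var)) (fst var))))

reduction : Fn ((nat ⊗ list (list literal)) ⊗ nat) ((nat ⊗ list (list nat)) ⊗ nat)
reduction =
  bind ((bind (expr (pair (snd (fst var)) (snd var)) ⟫ flatten)
          (expr (pair (snd (snd var)) (fst var))))
        ⟫ coverRows ⟫ emit)
  (expr (pair (fst var) (snd (snd var))))

-- Values of the arithmetic and list programs

monus-≡ : ∀ a b → ⟦ monus ⟧ (a , b) ≡ b ∸ a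
monus-≡ zero    b = refl
monus-≡ (suc a) b = trans (cong pred (monus-≡ a b)) (pred[m∸n]≡m∸[1+n] b a)

equal-≡ : ∀ a b → ⟦ equal ⟧ (a , b) ≡ does (a ≟ b)
equal-≡ a b with ⟦ monus ⟧ (a , b) in p
... | suc _ = sym (dec-false (a ≟ b) λ { refl → 1+n≢0 (trans (sym p) (trans (monus-≡ a a) (n∸n≡0 a))) })
... | zero with ⟦ monus ⟧ (b , a) in q
... | suc _ = sym (dec-false (a ≟ b) λ { refl → 1+n≢0 (trans (sym q) (trans (monus-≡ a a) (n∸n≡0 a))) })
... | zero  = sym (dec-true (a ≟ b) (≤-antisym (m∸n≡0⇒m≤n (trans (sym (monus-≡ b a)) q))
                                               (m∸n≡0⇒m≤n (trans (sym (monus-≡ a b)) p))))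

double-≡ : ∀ n → ⟦ double ⟧ n ≡ n + n
double-≡ zero    = refl
double-≡ (suc n) = cong suc (trans (cong suc (double-≡ n)) (sym (+-suc n n)))

append-≡ : ∀ {A} (as bs : List ⟦ A ⟧ᵗ) → ⟦ append {A} ⟧ (as , bs) ≡ as ++ bs
append-≡ []       bs = refl
append-≡ {A} (a ∷ as) bs = cong (a ∷_) (append-≡ {A} as bs)

len-≡ : ∀ {A} (as : List ⟦ A ⟧ᵗ) → ⟦ len {A} ⟧ as ≡ length as
len-≡ []       = refl
len-≡ {A} (a ∷ as) = cong suc (len-≡ {A} as)

countdown-≡ : ∀ n → ⟦ countdown ⟧ n ≡ downFrom n
countdown-≡ n = proj₂ (lem n)
  where
  st : ℕ → ℕ × List ℕ
  st n = foldr (λ _ s → suc (proj₁ s) , proj₁ s ∷ proj₂ s) (zero , []) (replicate n false)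
  lem : ∀ n → proj₁ (st n) ≡ n × proj₂ (st n) ≡ downFrom n
  lem zero    = refl , refl
  lem (suc n) = cong suc (proj₁ (lem n)) , cong₂ _∷_ (proj₁ (lem n)) (proj₂ (lem n))

Slot Decorated Row : Set
Slot      = ⟦ slot ⟧ᵗ
Decorated = ⟦ decorated ⟧ᵗ
Row       = ⟦ row ⟧ᵗ

sign : Slot → Bool
sign ((b , _) , _) = b

vari num header : Slot → ℕ
vari   ((_ , x) , _) = x
num    (_ , (p , _)) = p
header (_ , (_ , h)) = h

-- Numbering of clauses and occurrences

True : (ℕ → Bool) → Slot → Set
True α w = α (vari w) ≡ sign w

-- All that is used about the labels of a formula. `classify` serves the passage from a satisfying
-- assignment to a covering, and `clauseNo` the converse.
record Numbering (k m : ℕ) (F : CNF) (W : List Slot) : Set where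
  field
    size-≡     : m ≡ formulaSize F + k
    length-≤   : length W ≤ formulaSize F
    decreasing : AllPairs (λ w w′ → num w′ < num w) W
    num-bounds : All (λ w → k ≤ num w × num w < m) W
    header-bounds : All (λ w → k ≤ header w × header w < m) W
    header≢num : ∀ {w w′} → w ∈ W → w′ ∈ W → header w ≢ num w′
    classify   : ∀ u → k ≤ u → u < m → Any (λ w → num w ≡ u) W ⊎
                 (∃[ C ] C ∈ F × (∀ α → Any (λ (b , x) → α x ≡ b) C →
                                  Any (λ w → header w ≡ u × True α w) W))
    clauseNo   : ∀ {C} → C ∈ F → ∃[ u ] k ≤ u × u < m × All (λ w → num w ≢ u) W ×
                 (∀ α → Any (λ w → header w ≡ u × True α w) W → Any (λ (b , x) → α x ≡ b) C)

numbered : ℕ → ℕ → Clause → List Slot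
numbered h p []      = []
numbered h p (ℓ ∷ C) = (ℓ , (length C + p , h)) ∷ numbered h p C

flattenClause-≡ : ∀ h C p W →
  ⟦ flattenClause ⟧ (h , (C , (p , W))) ≡ (length C + p , numbered h p C ++ W)
flattenClause-≡ h []      p W = refl
flattenClause-≡ h (ℓ ∷ C) p W =
  cong (λ s → suc (proj₁ s) , (ℓ , (proj₁ s , h)) ∷ proj₂ s) (flattenClause-≡ h C p W)

numbered-length : ∀ h p C → length (numbered h p C) ≡ length C
numbered-length h p []      = refl
numbered-length h p (ℓ ∷ C) = cong suc (numbered-length h p C)

numbered-bounds : ∀ h p C → All (λ w → p ≤ num w × num w < length C + p) (numbered h p C)
numbered-bounds h p []      = []
numbered-bounds h p (ℓ ∷ C) =
  (m≤n+m p (length C) , ≤-refl) ∷ All.map (λ (a , b) → a , m≤n⇒m≤1+n b) (numbered-bounds h p C)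

numbered-header : ∀ h p C → All (λ w → header w ≡ h) (numbered h p C)
numbered-header h p []      = []
numbered-header h p (ℓ ∷ C) = refl ∷ numbered-header h p C

numbered-decreasing : ∀ h p C → AllPairs (λ w w′ → num w′ < num w) (numbered h p C)
numbered-decreasing h p []      = []
numbered-decreasing h p (ℓ ∷ C) =
  All.map proj₂ (numbered-bounds h p C) ∷ numbered-decreasing h p C

numbered-covers : ∀ h p C u → p ≤ u → u < length C + p → Any (λ w → num w ≡ u) (numbered h p C)
numbered-covers h p []      u p≤u u<p = ⊥-elim (<-irrefl refl (≤-trans u<p p≤u))
numbered-covers h p (ℓ ∷ C) u p≤u (s≤s u≤) with length C + p ≟ u
... | yes q = here q
... | no q  = there (numbered-covers h p C u p≤u (≤∧≢⇒< u≤ (q ∘ sym)))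

numbered-sat : ∀ h p C α → Any (λ (b , x) → α x ≡ b) C →
               Any (λ w → header w ≡ h × True α w) (numbered h p C)
numbered-sat h p (ℓ ∷ C) α (here q)  = here (refl , q)
numbered-sat h p (ℓ ∷ C) α (there q) = there (numbered-sat h p C α q)

numbered-sat⁻ : ∀ h p C α → Any (λ w → header w ≡ h × True α w) (numbered h p C) →
                Any (λ (b , x) → α x ≡ b) C
numbered-sat⁻ h p (ℓ ∷ C) α (here q)  = here (proj₂ q)
numbered-sat⁻ h p (ℓ ∷ C) α (there q) = there (numbered-sat⁻ h p C α q)

numbering-∷ : ∀ {k h F W} C → Numbering k h F W →
              Numbering k (length C + suc h) (C ∷ F) (numbered h (suc h) C ++ W)
numbering-∷ {k} {h} {F} {W} C N = record
  { size-≡     = trans (+-suc (length C) h)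
      (cong suc (trans (cong (length C +_) size-≡) (sym (+-assoc (length C) (formulaSize F) k))))
  ; length-≤   = ≤-trans (≤-reflexive (length-++ V)) (m≤n⇒m≤1+n
      (+-mono-≤ (≤-reflexive (numbered-length h (suc h) C)) length-≤))
  ; decreasing = AllPairs.++⁺ (numbered-decreasing h (suc h) C) decreasing
      (All.map (λ b → All.map (λ b′ → ≤-trans (proj₂ b′) (<⇒≤ (proj₁ b))) num-bounds) V-bounds)
  ; num-bounds = All.++⁺ (All.map (λ (a , b) → ≤-trans k≤h (<⇒≤ a) , b) V-bounds)
      (All.map (λ (a , b) → a , ≤-trans b h≤m) num-bounds)
  ; header-bounds = All.++⁺ (All.map (λ { refl → k≤h , h<m }) (numbered-header h (suc h) C))
      (All.map (λ (a , b) → a , ≤-trans b h≤m) header-bounds)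
  ; header≢num = λ {w} {w′} p q → h≢n {w} {w′} (Any.++⁻ V p) (Any.++⁻ V q)
  ; classify   = cl
  ; clauseNo   = cn
  }
  where
  open Numbering N
  V = numbered h (suc h) C
  V-bounds = numbered-bounds h (suc h) C
  k≤h : k ≤ h
  k≤h = subst (k ≤_) (sym size-≡) (m≤n+m k (formulaSize F))
  h<m : h < length C + suc h
  h<m = m≤n+m (suc h) (length C)
  h≤m = <⇒≤ h<m
  h≢n : ∀ {w w′} → w ∈ V ⊎ w ∈ W → w′ ∈ V ⊎ w′ ∈ W → header w ≢ num w′
  h≢n (inj₁ p) (inj₁ q) e = <-irrefl (trans (sym (All.lookup (numbered-header h (suc h) C) p)) e)
                                     (proj₁ (All.lookup V-bounds q))
  h≢n (inj₁ p) (inj₂ q) e = <-irrefl (trans (sym e) (All.lookup (numbered-header h (suc h) C) p))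
                                     (proj₂ (All.lookup num-bounds q))
  h≢n (inj₂ p) (inj₁ q) e = <-irrefl e (<-trans (proj₂ (All.lookup header-bounds p))
                                                (proj₁ (All.lookup V-bounds q)))
  h≢n (inj₂ p) (inj₂ q) e = header≢num p q e
  cl : ∀ u → k ≤ u → u < length C + suc h → _
  cl u k≤u u<m with <-cmp u h
  ... | tri< u<h _ _ with classify u k≤u u<h
  ... | inj₁ p = inj₁ (Any.++⁺ʳ V p)
  ... | inj₂ (D , D∈ , f) = inj₂ (D , there D∈ , λ α q → Any.++⁺ʳ V (f α q))
  cl u k≤u u<m | tri≈ _ refl _ = inj₂ (C , here refl , λ α q → Any.++⁺ˡ (numbered-sat h (suc h) C α q))
  cl u k≤u u<m | tri> _ _ h<u = inj₁ (Any.++⁺ˡ (numbered-covers h (suc h) C u h<u u<m))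
  cn : ∀ {D} → D ∈ C ∷ F → _
  cn (here refl) = h , k≤h , h<m ,
    All.++⁺ (All.map (λ (a , _) e → <-irrefl (sym e) a) V-bounds)
            (All.map (λ (_ , b) e → <-irrefl e b) num-bounds) ,
    λ α q → numbered-sat⁻ h (suc h) C α (inV α (Any.++⁻ V q))
    where
    inV : ∀ α → Any (λ w → header w ≡ h × True α w) V ⊎ Any (λ w → header w ≡ h × True α w) W →
          Any (λ w → header w ≡ h × True α w) V
    inV α (inj₁ q) = q
    inV α (inj₂ q) = ⊥-elim (All.lookupWith (λ (_ , b) (e , _) → <-irrefl e b) header-bounds q)
  cn (there D∈) with clauseNo D∈
  ... | u , k≤u , u<h , ≢u , f = u , k≤u , ≤-trans u<h h≤m ,
    All.++⁺ (All.map (λ (a , _) e → <-irrefl (sym e) (<-trans u<h a)) V-bounds) ≢u ,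
    λ α q → f α (inW α (Any.++⁻ V q))
    where
    inW : ∀ α → Any (λ w → header w ≡ u × True α w) V ⊎ Any (λ w → header w ≡ u × True α w) W →
          Any (λ w → header w ≡ u × True α w) W
    inW α (inj₁ q) = ⊥-elim (All.lookupWith (λ e (e′ , _) → <-irrefl (trans (sym e′) e) u<h)
                              (numbered-header h (suc h) C) q)
    inW α (inj₂ q) = q

flatten-numbering : ∀ k F → let (m , W) = ⟦ flatten ⟧ (F , k) in Numbering k m F W
flatten-numbering k []      = record
  { size-≡ = refl ; length-≤ = z≤n ; decreasing = [] ; num-bounds = [] ; header-bounds = []
  ; header≢num = λ () ; classify = λ u k≤u u<k → ⊥-elim (<-irrefl refl (≤-trans u<k k≤u))
  ; clauseNo = λ () }
flatten-numbering k (C ∷ F) =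
  subst (λ s → Numbering k (proj₁ s) (C ∷ F) (proj₂ s))
    (sym (flattenClause-≡ _ C _ _)) (numbering-∷ C (flatten-numbering k F))

-- Pointers to the next occurrence

lookupVar : ℕ → ℕ → List Slot → ℕ
lookupVar x d []      = d
lookupVar x d (w ∷ W) = ifᵇ does (x ≟ vari w) then num w else lookupVar x d W

findSlot-≡ : ∀ x d W → ⟦ findSlot ⟧ ((x , d) , W) ≡ lookupVar x d W
findSlot-≡ x d []      = refl
findSlot-≡ x d (w ∷ W) =
  cong₂ (λ c n → ifᵇ c then num w else n) (equal-≡ x (vari w)) (findSlot-≡ x d W)

pointers : List Slot → List Slot → List (Slot × ℕ)
pointers W []      = []
pointers W (w ∷ l) = (w , lookupVar (vari w) (lookupVar (vari w) (num w) W) l) ∷ pointers W l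

next-≡ : ∀ W w l acc → ⟦ next ⟧ (W , (w , (l , acc))) ≡ lookupVar (vari w) (lookupVar (vari w) (num w) W) l
next-≡ W w l acc = trans (findSlot-≡ (vari w) _ l)
  (cong (λ d → lookupVar (vari w) d l) (findSlot-≡ (vari w) (num w) W))

decorateState : List Slot → List Slot → List Slot × List Decorated
decorateState W l = ⟦ fold decorateStep ⟧ (W , (l , ([] , [])))

decorateState-≡ : ∀ W l → decorateState W l ≡ (l , map ⟦ labels ⟧ (pointers W l))
decorateState-≡ W []      = refl
decorateState-≡ W (w ∷ l) = cong₂ _,_ (cong (w ∷_) (cong proj₁ (decorateState-≡ W l)))
  (cong₂ (λ q qs → ⟦ labels ⟧ (w , q) ∷ qs)
    (trans (next-≡ W w (proj₁ st) (proj₂ st))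
      (cong (lookupVar (vari w) (lookupVar (vari w) (num w) W)) (cong proj₁ (decorateState-≡ W l))))
    (cong proj₂ (decorateState-≡ W l)))
  where
  st = decorateState W l

decorate-≡ : ∀ W → ⟦ decorate ⟧ W ≡ map ⟦ labels ⟧ (pointers W W)
decorate-≡ W = cong proj₂ (decorateState-≡ W W)

lookupVar-none : ∀ x d l → ¬ Any (λ w → vari w ≡ x) l → lookupVar x d l ≡ d
lookupVar-none x d []      none = refl
lookupVar-none x d (w ∷ l) none with x ≡ᵇ vari w | proof (x ≟ vari w)
... | true | ofʸ e = ⊥-elim (none (here (sym e)))
... | false | ofⁿ _  = lookupVar-none x d l (none ∘ there)

-- As numbers decrease along `l`, the first slot found is the one with the greatest number.
lookupVar-cases : ∀ x d l → AllPairs (λ w w′ → num w′ < num w) l →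
  (∃[ w ] w ∈ l × vari w ≡ x × num w ≡ lookupVar x d l ×
    (∀ {v} → v ∈ l → vari v ≡ x → num v ≤ lookupVar x d l)) ⊎
  (lookupVar x d l ≡ d × (∀ {v} → v ∈ l → vari v ≢ x))
lookupVar-cases x d []      dec = inj₂ (refl , λ ())
lookupVar-cases x d (w ∷ l) (w> ∷ dec) with x ≡ᵇ vari w | proof (x ≟ vari w)
... | true | ofʸ e = inj₁ (w , here refl , sym e , refl ,
  λ { (here refl) _ → ≤-refl ; (there v∈) _ → <⇒≤ (All.lookup w> v∈) })
... | false | ofⁿ ¬e with lookupVar-cases x d l dec
... | inj₁ (w′ , w′∈ , e , n , f) = inj₁ (w′ , there w′∈ , e , n ,
  λ { (here refl) e′ → ⊥-elim (¬e (sym e′)) ; (there v∈) → f v∈ })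
... | inj₂ (e , f) = inj₂ (e , λ { (here refl) e′ → ¬e (sym e′) ; (there v∈) → f v∈ })

num-injective : ∀ {W} → AllPairs (λ w w′ → num w′ < num w) W →
                ∀ {v w} → v ∈ W → w ∈ W → num v ≡ num w → v ≡ w
num-injective (_ ∷ _)  (here refl) (here refl) e = refl
num-injective (w> ∷ _) (here refl) (there w∈)  e = ⊥-elim (<-irrefl (sym e) (All.lookup w> w∈))
num-injective (w> ∷ _) (there v∈)  (here refl) e = ⊥-elim (<-irrefl e (All.lookup w> v∈))
num-injective (_ ∷ ps) (there v∈)  (there w∈)  e = num-injective ps v∈ w∈ e

-- The cyclic order expressed by numbers alone: one step down among the occurrences of the variable,
-- or from the least of them back to the greatest.
NextIn : List Slot → Slot × ℕ → Set
NextIn W (w , q) = w ∈ W × (∃[ v ] v ∈ W × vari v ≡ vari w × num v ≡ q) ×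
  ((∀ {v} → v ∈ W → vari v ≡ vari w → num v < num w → num v ≤ q) × q < num w ⊎
   (∀ {v} → v ∈ W → vari v ≡ vari w → num w ≤ num v × num v ≤ q))

pointers-next : ∀ W → AllPairs (λ w w′ → num w′ < num w) W → All (NextIn W) (pointers W W)
pointers-next W dec = go W dec (λ p → p) inj₁
  where
  go : ∀ l → AllPairs (λ w w′ → num w′ < num w) l → (∀ {v} → v ∈ l → v ∈ W) →
       (∀ {v} → v ∈ W → v ∈ l ⊎ All (λ w → num w < num v) l) → All (NextIn W) (pointers W l)
  go []      _          _  _ = []
  go (w ∷ l) (w> ∷ ldec) l⊆ rest = next-w ∷ go l ldec (l⊆ ∘ there) rest′
    where
    x = vari w
    rest′ : ∀ {v} → v ∈ W → v ∈ l ⊎ All (λ w → num w < num v) l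
    rest′ v∈ with rest v∈
    ... | inj₁ (here refl) = inj₂ w>
    ... | inj₁ (there v∈l) = inj₁ v∈l
    ... | inj₂ (_ ∷ all)   = inj₂ all
    before : ∀ {v} → v ∈ W → v ∈ l ⊎ num w ≤ num v
    before v∈ with rest v∈
    ... | inj₁ (here refl) = inj₂ ≤-refl
    ... | inj₁ (there v∈l) = inj₁ v∈l
    ... | inj₂ (w< ∷ _)    = inj₂ (<⇒≤ w<)
    next-w : NextIn W (w , lookupVar x (lookupVar x (num w) W) l)
    next-w with lookupVar-cases x (lookupVar x (num w) W) l ldec
    ... | inj₁ (v , v∈ , e , n , f) = l⊆ (here refl) , (v , l⊆ (there v∈) , e , n) ,
      inj₁ ((λ u∈ eᵤ u<w → f (inl (before u∈) u<w) eᵤ) , subst (_< num w) n (All.lookup w> v∈))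
      where
      inl : ∀ {u} → u ∈ l ⊎ num w ≤ num u → num u < num w → u ∈ l
      inl (inj₁ u∈) _  = u∈
      inl (inj₂ w≤) u< = ⊥-elim (<-irrefl refl (<-≤-trans u< w≤))
    -- Here `w` is the last slot of its variable and so has the least number; the default is the
    -- first one in `W`, with the greatest number.
    ... | inj₂ (e , none) with lookupVar-cases x (num w) W dec
    ... | inj₁ (v , v∈ , eᵥ , n , f) = l⊆ (here refl) , (v , v∈ , eᵥ , trans n (sym e)) ,
      inj₂ (λ u∈ eᵤ → outr (before u∈) eᵤ , subst (_ ≤_) (sym e) (f u∈ eᵤ))
      where
      outr : ∀ {u} → u ∈ l ⊎ num w ≤ num u → vari u ≡ x → num w ≤ num u
      outr (inj₁ u∈) eᵤ = ⊥-elim (none u∈ eᵤ)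
      outr (inj₂ w≤) _  = w≤
    ... | inj₂ (_ , noneW) = ⊥-elim (noneW (l⊆ (here refl)) refl)

-- Either an earlier slot of the variable points to `w`, or `w` is its first slot and the last one
-- points to it by wrapping around.
pointers-onto : ∀ W {w} → w ∈ W → Any (λ (v , q) → vari v ≡ vari w × q ≡ num w) (pointers W W)
pointers-onto W {w} w∈ with firstOrNext W w∈
  where
  firstOrNext : ∀ l {w} → w ∈ l → Any (λ (v , q) → vari v ≡ vari w × q ≡ num w) (pointers W l) ⊎
                (∀ d → lookupVar (vari w) d l ≡ num w)
  firstOrNext (v ∷ l) (here refl) with vari v ≡ᵇ vari v | proof (vari v ≟ vari v)
  ... | true | ofʸ _ = inj₂ (λ _ → refl)
  ... | false | ofⁿ ¬e = ⊥-elim (¬e refl)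
  firstOrNext (v ∷ l) {w} (there w∈) with firstOrNext l w∈
  ... | inj₁ p = inj₁ (there p)
  ... | inj₂ f with vari w ≡ᵇ vari v | proof (vari w ≟ vari v)
  ... | false | ofⁿ _  = inj₂ f
  ... | true | ofʸ e = inj₁ (here (sym e , subst (λ x → lookupVar x (lookupVar x (num v) W) l ≡ num w) e (f _)))
... | inj₁ p = p
... | inj₂ f = last W (Any.map (cong vari ∘ sym) w∈)
  where
  last : ∀ l → Any (λ v → vari v ≡ vari w) l → Any (λ (v , q) → vari v ≡ vari w × q ≡ num w) (pointers W l)
  last (v ∷ l) p with Any.any? (λ v → vari v ≟ vari w) l
  ... | yes q = there (last l q)
  last (v ∷ l) (there p) | no ¬q = ⊥-elim (¬q p)
  last (v ∷ l) (here e)  | no ¬q = here (e , subst (λ x → lookupVar x (lookupVar x (num v) W) l ≡ num w)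
    (sym e) (trans (lookupVar-none (vari w) _ l ¬q) (f (num v))))

-- Coverings and satisfying assignments

pick : Bool → Decorated → ℕ × ℕ
pick β q = ifᵇ β then proj₂ q else proj₁ q

Covers : ℕ → Decorated × Bool → Set
Covers ℓ (q , β) = ℓ ≡ proj₁ (pick β q) ⊎ ℓ ≡ proj₂ (pick β q)

Entry : Set
Entry = (Slot × ℕ) × Bool

decorateEntry : Entry → Decorated × Bool
decorateEntry (wq , β) = ⟦ labels ⟧ wq , β

CoversCases : ℕ → Entry → Set
CoversCases ℓ ((w , q) , β) =
  (β ≡ false × ℓ ≡ num w) ⊎ (β ≡ true × ℓ ≡ q) ⊎ (β ≡ sign w × ℓ ≡ header w)

covers-cases : ∀ ℓ e → Covers ℓ (decorateEntry e) → CoversCases ℓ e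
covers-cases ℓ ((((true , _) , _) , _) , true)  (inj₁ p) = inj₂ (inj₁ (refl , p))
covers-cases ℓ ((((true , _) , _) , _) , true)  (inj₂ p) = inj₂ (inj₂ (refl , p))
covers-cases ℓ ((((true , _) , _) , _) , false) (inj₁ p) = inj₁ (refl , p)
covers-cases ℓ ((((true , _) , _) , _) , false) (inj₂ p) = inj₁ (refl , p)
covers-cases ℓ ((((false , _) , _) , _) , true)  (inj₁ p) = inj₂ (inj₁ (refl , p))
covers-cases ℓ ((((false , _) , _) , _) , true)  (inj₂ p) = inj₂ (inj₁ (refl , p))
covers-cases ℓ ((((false , _) , _) , _) , false) (inj₁ p) = inj₁ (refl , p)
covers-cases ℓ ((((false , _) , _) , _) , false) (inj₂ p) = inj₂ (inj₂ (refl , p))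

cases-covers : ∀ ℓ e → CoversCases ℓ e → Covers ℓ (decorateEntry e)
cases-covers ℓ ((((true , _) , _) , _) , true)   (inj₂ (inj₁ (refl , p))) = inj₁ p
cases-covers ℓ ((((true , _) , _) , _) , true)   (inj₂ (inj₂ (refl , p))) = inj₂ p
cases-covers ℓ ((((true , _) , _) , _) , false)  (inj₁ (refl , p))        = inj₁ p
cases-covers ℓ ((((true , _) , _) , _) , false)  (inj₂ (inj₁ (() , _)))
cases-covers ℓ ((((true , _) , _) , _) , false)  (inj₂ (inj₂ (() , _)))
cases-covers ℓ ((((false , _) , _) , _) , true)  (inj₂ (inj₁ (refl , p))) = inj₁ p
cases-covers ℓ ((((false , _) , _) , _) , false) (inj₁ (refl , p))        = inj₁ p
cases-covers ℓ ((((false , _) , _) , _) , false) (inj₂ (inj₂ (refl , p))) = inj₂ p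

pointers-slots : ∀ W l → map proj₁ (pointers W l) ≡ l
pointers-slots W []      = refl
pointers-slots W (w ∷ l) = cong (w ∷_) (pointers-slots W l)

module _ {k m F W} (N : Numbering k m F W) where
  open Numbering N

  assigned : (ℕ → Bool) → List Entry
  assigned α = map (λ (w , q) → (w , q) , α (vari w)) (pointers W W)

  satisfies⇒covers : ∀ α → Satisfies α F → ∀ u → k ≤ u → u < m →
                     Any (CoversCases u) (assigned α)
  satisfies⇒covers α sat u k≤u u<m with classify u k≤u u<m
  ... | inj₂ (C , C∈ , f) with find (f α (All.lookup sat C∈))
  ... | w , w∈ , e , t with ∈-map⁻ proj₁ (subst (w ∈_) (sym (pointers-slots W W)) w∈)
  ... | (_ , q) , p∈ , refl = Any.map⁺ (lose p∈ (inj₂ (inj₂ (t , sym e))))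
  satisfies⇒covers α sat u k≤u u<m | inj₁ p with find p
  ... | w , w∈ , refl with α (vari w) in αw
  ... | false with ∈-map⁻ proj₁ (subst (w ∈_) (sym (pointers-slots W W)) w∈)
  ... | (_ , q) , p∈ , refl = Any.map⁺ (lose p∈ (inj₁ (αw , refl)))
  satisfies⇒covers α sat u k≤u u<m | inj₁ p | w , w∈ , refl | true =
    Any.map⁺ (Any.map (λ { {v , q} (e , refl) → inj₂ (inj₁ (trans (cong α e) αw , refl)) }) (pointers-onto W w∈))

  module _ (E : List Entry) (E≡ : map proj₁ E ≡ pointers W W)
           (cover : ∀ u → k ≤ u → u < m → Any (CoversCases u) E) where

    E-next : ∀ {e} → e ∈ E → NextIn W (proj₁ e)
    E-next e∈ = All.lookup (pointers-next W decreasing) (subst (_ ∈_) E≡ (∈-map⁺ proj₁ e∈))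

    nth : Entry → ℕ
    nth ((w , _) , _) = num w

    variₑ : Entry → ℕ
    variₑ ((w , _) , _) = vari w

    E-decreasing : AllPairs (λ e e′ → nth e′ < nth e) E
    E-decreasing = AllPairs.map⁻ {f = proj₁} (AllPairs.map⁻ {f = proj₁} (subst (AllPairs _)
      (sym (trans (cong (map proj₁) E≡) (pointers-slots W W))) decreasing))

    unique : ∀ {e e′} → e ∈ E → e′ ∈ E → nth e ≡ nth e′ → e ≡ e′
    unique = go E-decreasing
      where
      go : ∀ {E} → AllPairs (λ e e′ → nth e′ < nth e) E →
           ∀ {e e′} → e ∈ E → e′ ∈ E → nth e ≡ nth e′ → e ≡ e′
      go (_ ∷ _)  (here refl) (here refl) q = refl
      go (e> ∷ _) (here refl) (there e′∈) q = ⊥-elim (<-irrefl (sym q) (All.lookup e> e′∈))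
      go (e> ∷ _) (there e∈)  (here refl) q = ⊥-elim (<-irrefl q (All.lookup e> e∈))
      go (_ ∷ ps) (there e∈)  (there e′∈) q = go ps e∈ e′∈ q

    -- Truth travels against the pointers. The label of `w` is no header, and an entry valued false
    -- with this number would be the entry of `w` itself, which is valued true; so an entry valued
    -- true and pointing to `w` has to cover it.
    pointing : ∀ {w q} → ((w , q) , true) ∈ E →
               ∃[ w′ ] ((w′ , num w) , true) ∈ E × vari w′ ≡ vari w
    pointing {w} e∈ with E-next e∈
    ... | w∈ , _ with All.lookup num-bounds w∈
    ... | k≤ , <m with find (cover (num w) k≤ <m)
    ... | ((w′ , q′) , β) , e′∈ , inj₁ (refl , e) with () ← unique e∈ e′∈ e
    ... | ((w′ , q′) , β) , e′∈ , inj₂ (inj₂ (_ , e)) =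
      ⊥-elim (header≢num (proj₁ (E-next e′∈)) w∈ (sym e))
    ... | ((w′ , _) , _) , e′∈ , inj₂ (inj₁ (refl , refl)) with E-next e′∈
    ... | _ , (v , v∈ , e , n) , _ =
      w′ , e′∈ , trans (sym e) (cong vari (num-injective decreasing v∈ w∈ n))

    -- Short of wrapping around, following a pointer backwards leads to the next greater number of
    -- the variable, so truth climbs from `e` to `r`. The fuel `n` bounds the climb that is left.
    upwards : ∀ n {e r} → e ∈ E → proj₂ e ≡ true → r ∈ E → variₑ r ≡ variₑ e →
              nth e ≤ nth r → nth r ≤ nth e + n → proj₂ r ≡ true
    upwards n {e} {r} e∈ t r∈ v e≤r r≤ with m≤n⇒m<n∨m≡n e≤r
    ... | inj₂ q = trans (cong proj₂ (sym (unique e∈ r∈ q))) t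
    upwards zero {e} {r} e∈ t r∈ v e≤r r≤ | inj₁ e<r =
      ⊥-elim (<-irrefl refl (<-≤-trans e<r (≤-trans r≤ (≤-reflexive (+-identityʳ _)))))
    upwards (suc n) {e} {r} e∈ refl r∈ v e≤r r≤ | inj₁ e<r with pointing e∈
    ... | w′ , e′∈ , v′ with E-next e′∈
    ... | _ , _ , inj₂ f = ⊥-elim (<-irrefl refl
      (<-≤-trans e<r (proj₂ (f (proj₁ (E-next r∈)) (trans v (sym v′))))))
    ... | _ , _ , inj₁ (f , e<e′) = upwards n e′∈ refl r∈ (trans v (sym v′))
      (≮⇒≥ (λ r<e′ → <-irrefl refl (<-≤-trans e<r (f (proj₁ (E-next r∈)) (trans v (sym v′)) r<e′))))
      (≤-trans r≤ (≤-trans (≤-reflexive (+-suc _ n)) (+-monoˡ-≤ n e<e′)))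

    -- Truth climbs until a pointer wraps around, which happens before the numbers reach `m`. The
    -- predecessor is then the least occurrence of the variable, and `upwards` reaches every `r`
    -- from there.
    everywhere : ∀ n {e r} → e ∈ E → proj₂ e ≡ true → r ∈ E → variₑ r ≡ variₑ e →
                 m ≤ nth e + n → proj₂ r ≡ true
    everywhere zero e∈ t r∈ v m≤ = ⊥-elim (<-irrefl refl
      (<-≤-trans (proj₂ (All.lookup num-bounds (proj₁ (E-next e∈)))) (≤-trans m≤ (≤-reflexive (+-identityʳ _)))))
    everywhere (suc n) {e} {r} e∈ refl r∈ v m≤ with pointing e∈
    ... | w′ , e′∈ , v′ with E-next e′∈
    ... | _ , _ , inj₁ (_ , e<e′) = everywhere n e′∈ refl r∈ (trans v (sym v′))
      (≤-trans m≤ (≤-trans (≤-reflexive (+-suc _ n)) (+-monoˡ-≤ n e<e′)))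
    ... | _ , _ , inj₂ f =
      upwards (nth r) e′∈ refl r∈ (trans v (sym v′)) (proj₁ (f (proj₁ (E-next r∈)) (trans v (sym v′))))
        (m≤n+m (nth r) _)

    consistent : ∀ {e r} → e ∈ E → r ∈ E → variₑ e ≡ variₑ r → proj₂ e ≡ proj₂ r
    consistent {_ , true}  e∈ r∈ v = sym (everywhere m e∈ refl r∈ (sym v) (m≤n+m m _))
    consistent {_ , false} {_ , true} e∈ r∈ v = everywhere m r∈ refl e∈ v (m≤n+m m _)
    consistent {_ , false} {_ , false} e∈ r∈ v = refl

    readOff : List Entry → ℕ → Bool
    readOff []      x = false
    readOff (e ∷ l) x = ifᵇ does (variₑ e ≟ x) then proj₂ e else readOff l x

    readOff-∈ : ∀ l {e} → e ∈ l → ∃[ r ] r ∈ l × variₑ r ≡ variₑ e × readOff l (variₑ e) ≡ proj₂ r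
    readOff-∈ (f ∷ l) {e} e∈ with variₑ f ≡ᵇ variₑ e | proof (variₑ f ≟ variₑ e)
    ... | true | ofʸ q = f , here refl , q , refl
    readOff-∈ (f ∷ l) (here refl) | false | ofⁿ ¬q = ⊥-elim (¬q refl)
    readOff-∈ (f ∷ l) (there e∈)  | false | ofⁿ ¬q with readOff-∈ l e∈
    ... | r , r∈ , q , p = r , there r∈ , q , p

    -- The label of a clause is the number of no occurrence, and so the target of no pointer; only
    -- an occurrence whose value satisfies the clause can cover it. By `consistent`, the assignment
    -- read off agrees with that value.
    covers⇒satisfies : Satisfies (readOff E) F
    covers⇒satisfies = All.tabulate λ C∈ → holds C∈
      where
      holds : ∀ {C} → C ∈ F → Any (λ (b , x) → readOff E x ≡ b) C
      holds C∈ with clauseNo C∈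
      ... | u , k≤u , u<m , ≢u , f with find (cover u k≤u u<m)
      ... | ((w , q) , β) , e∈ , inj₁ (_ , refl) = ⊥-elim (All.lookup ≢u (proj₁ (E-next e∈)) refl)
      ... | ((w , q) , β) , e∈ , inj₂ (inj₁ (_ , refl)) with E-next e∈
      ... | _ , (v , v∈ , _ , n) , _ = ⊥-elim (All.lookup ≢u v∈ n)
      holds C∈ | u , k≤u , u<m , ≢u , f | ((w , q) , β) , e∈ , inj₂ (inj₂ (refl , refl)) with readOff-∈ E e∈
      ... | r , r∈ , v , p = f (readOff E) (lose (proj₁ (E-next e∈))
        (refl , trans p (sym (consistent e∈ r∈ (sym v)))))

-- Rows of a block

labelled : Bool → Decorated → Row → Row
labelled β q r = proj₁ (pick β q) ∷ proj₂ (pick β q) ∷ r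

extend-∈⁻ : ∀ q R {r} → r ∈ ⟦ extend ⟧ (q , R) → ∃[ β ] ∃[ r′ ] r′ ∈ R × r ≡ labelled β q r′
extend-∈⁻ q (r ∷ R) (here refl)         = false , r , here refl , refl
extend-∈⁻ q (r ∷ R) (there (here refl)) = true , r , here refl , refl
extend-∈⁻ q (r ∷ R) (there (there r∈)) with extend-∈⁻ q R r∈
... | β , r′ , r′∈ , e = β , r′ , there r′∈ , e

extend-∈⁺ : ∀ q R {r} β → r ∈ R → labelled β q r ∈ ⟦ extend ⟧ (q , R)
extend-∈⁺ q (r ∷ R) false (here refl) = here refl
extend-∈⁺ q (r ∷ R) true  (here refl) = there (here refl)
extend-∈⁺ q (r ∷ R) β     (there r∈)  = there (there (extend-∈⁺ q R β r∈))

extend-length : ∀ q R → length (⟦ extend ⟧ (q , R)) ≡ 2 * length R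
extend-length q []      = refl
extend-length q (r ∷ R) = trans (cong (suc ∘ suc) (extend-length q R)) (sym (*-suc 2 (length R)))

module Piece (u : ℕ) (D : List Decorated) where

  rest : ℕ → List Decorated
  rest s = proj₁ (⟦ piece ⟧ (s , (u , D)))

  rows : ℕ → List Row
  rows s = proj₂ (⟦ piece ⟧ (s , (u , D)))

  rest-length : ∀ s → length (rest s) ≡ length D ∸ s
  rest-length zero    = refl
  rest-length (suc s) = trans (tailₗ-length (rest s))
    (trans (cong pred (rest-length s)) (pred[m∸n]≡m∸[1+n] (length D) s))
    where
    tailₗ-length : ∀ {A : Set} (l : List A) → length (tailₗ l) ≡ pred (length l)
    tailₗ-length []      = refl
    tailₗ-length (_ ∷ _) = refl

  rows-length : ∀ s → length (rows s) ≡ 2 ^ s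
  rows-length zero    = refl
  rows-length (suc s) = trans (extend-length _ (rows s)) (cong (2 *_) (rows-length s))

  row-length : ∀ s {r} → r ∈ rows s → length r ≡ suc (s * 2)
  row-length zero    (here refl) = refl
  row-length (suc s) r∈ with extend-∈⁻ _ (rows s) r∈
  ... | β , r′ , r′∈ , refl = cong (suc ∘ suc) (row-length s r′∈)

  rows-sound : ∀ s {r} → r ∈ rows s →
    ∃[ A ] D ≡ map proj₁ A ++ rest s × (∀ {ℓ} → ℓ ∈ r → ℓ ≡ u ⊎ Any (Covers ℓ) A)
  rows-sound zero (here refl) = [] , refl , λ { (here e) → inj₁ e }
  rows-sound (suc s) r∈ with extend-∈⁻ _ (rows s) r∈
  ... | β , r′ , r′∈ , refl with rows-sound s r′∈
  ... | A , e , f with rest s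
  ... | [] = A , e , λ { (here e) → inj₁ (trans e (pad₁ β)) ; (there (here e)) → inj₁ (trans e (pad₂ β)) ; (there (there ℓ∈)) → f ℓ∈ }
    where
    pad₁ : ∀ β → proj₁ (pick β ((u , u) , (u , u))) ≡ u
    pad₁ false = refl
    pad₁ true  = refl
    pad₂ : ∀ β → proj₂ (pick β ((u , u) , (u , u))) ≡ u
    pad₂ false = refl
    pad₂ true  = refl
  ... | q ∷ D′ = A ++ (q , β) ∷ [] ,
    trans e (trans (sym (++-assoc (map proj₁ A) (q ∷ []) D′)) (cong (_++ D′) (sym (map-++ proj₁ A _)))) ,
    λ { (here e) → inj₂ (Any.++⁺ʳ A (here (inj₁ e)))
      ; (there (here e)) → inj₂ (Any.++⁺ʳ A (here (inj₂ e)))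
      ; (there (there ℓ∈)) → old (f ℓ∈) }
    where
    old : ∀ {ℓ} → ℓ ≡ u ⊎ Any (Covers ℓ) A → ℓ ≡ u ⊎ Any (Covers ℓ) (A ++ (q , β) ∷ [])
    old (inj₁ p) = inj₁ p
    old (inj₂ p) = inj₂ (Any.++⁺ˡ p)

  rows-complete : ∀ s A → map proj₁ A ≡ D →
    ∃[ r ] r ∈ rows s × u ∈ r ×
    ∃[ A′ ] map proj₁ A′ ≡ rest s × (∀ {e} → e ∈ A → e ∈ A′ ⊎ (∀ {ℓ} → Covers ℓ e → ℓ ∈ r))
  rows-complete zero A A≡ = (u ∷ []) , here refl , here refl , A , A≡ , inj₁
  rows-complete (suc s) A A≡ with rows-complete s A A≡
  -- No occurrences are left, so only the labels already in `r` are needed and the value `false` is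
  -- arbitrary.
  ... | r , r∈ , u∈ , [] , A′≡ , f = labelled false (⟦ headOr {decorated} ⟧ (((u , u) , (u , u)) , rest s)) r , extend-∈⁺ _ (rows s) false r∈ , there (there u∈) ,
    [] , cong tailₗ A′≡ , λ e∈ → new (f e∈)
    where
    new : ∀ {e a b} → e ∈ [] ⊎ (∀ {ℓ} → Covers ℓ e → ℓ ∈ r) → e ∈ [] ⊎ (∀ {ℓ} → Covers ℓ e → ℓ ∈ a ∷ b ∷ r)
    new (inj₂ g) = inj₂ (λ c → there (there (g c)))
  ... | r , r∈ , u∈ , (q , β) ∷ A′ , A′≡ , f with rest s
  rows-complete (suc s) A A≡ | r , r∈ , u∈ , (q , β) ∷ A′ , refl , f | .q ∷ .(map proj₁ A′) =
    labelled β q r , extend-∈⁺ q (rows s) β r∈ , there (there u∈) , A′ , refl , λ e∈ → new (f e∈)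
    where
    new : ∀ {e} → e ∈ (q , β) ∷ A′ ⊎ (∀ {ℓ} → Covers ℓ e → ℓ ∈ r) →
          e ∈ A′ ⊎ (∀ {ℓ} → Covers ℓ e → ℓ ∈ labelled β q r)
    new (inj₁ (here refl)) = inj₂ λ { (inj₁ p) → here p ; (inj₂ p) → there (here p) }
    new (inj₁ (there e∈))  = inj₁ e∈
    new (inj₂ g)           = inj₂ (λ c → there (there (g c)))

module Pieces (s : ℕ) (D : List Decorated) where

  remaining : ℕ → List Decorated
  remaining j = proj₁ (⟦ pieces ⟧ (s , (downFrom j , D)))

  allRows : ℕ → List Row
  allRows j = proj₂ (⟦ pieces ⟧ (s , (downFrom j , D)))

  open Piece

  rowsOf : ℕ → List Row
  rowsOf u = rows u (remaining u) s

  allRows-suc : ∀ m → allRows (suc m) ≡ rowsOf m ++ allRows m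
  allRows-suc m = append-≡ {row} (rowsOf m) (allRows m)

  allRows-∈⁻ : ∀ m {r} → r ∈ allRows m → ∃[ u ] u < m × r ∈ rowsOf u
  allRows-∈⁻ (suc m) r∈ with ∈-++⁻ (rowsOf m) (subst (_ ∈_) (allRows-suc m) r∈)
  ... | inj₁ p = m , ≤-refl , p
  ... | inj₂ p with allRows-∈⁻ m p
  ... | u , u<m , q = u , m≤n⇒m≤1+n u<m , q

  allRows-∈⁺ : ∀ {m u r} → u < m → r ∈ rowsOf u → r ∈ allRows m
  allRows-∈⁺ {suc m} {u} {r} u<m r∈ with m≤n⇒m<n∨m≡n (s≤s⁻¹ u<m)
  ... | inj₁ u<m′ = subst (r ∈_) (sym (allRows-suc m)) (∈-++⁺ʳ (rowsOf m) (allRows-∈⁺ u<m′ r∈))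
  ... | inj₂ refl = subst (r ∈_) (sym (allRows-suc m)) (∈-++⁺ˡ r∈)

  allRows-length : ∀ m → length (allRows m) ≡ m * 2 ^ s
  allRows-length zero    = refl
  allRows-length (suc m) = trans (cong length (allRows-suc m)) (trans (length-++ (rowsOf m))
    (cong₂ _+_ (rows-length m (remaining m) s) (allRows-length m)))

  allRows-row-length : ∀ m {r} → r ∈ allRows m → length r ≡ suc (s * 2)
  allRows-row-length m r∈ with allRows-∈⁻ m r∈
  ... | u , _ , p = row-length u (remaining u) s p

  remaining-length : ∀ j → length (remaining j) ≡ length D ∸ j * s
  remaining-length zero    = refl
  remaining-length (suc j) = trans (rest-length j (remaining j) s)
    (trans (cong (_∸ s) (remaining-length j))
      (trans (∸-+-assoc (length D) (j * s) s) (cong (length D ∸_) (+-comm (j * s) s))))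

  -- `rows-sound` describes the consumed occurrences only by way of a row of the block; giving all
  -- of them the value `false` produces such a row.
  remaining-suffix : ∀ j → ∃[ D′ ] D ≡ D′ ++ remaining j
  remaining-suffix zero    = [] , refl
  remaining-suffix (suc j) with remaining-suffix j | rows-complete j (remaining j) s
    (map (_, false) (remaining j)) (trans (sym (map-∘ (remaining j))) (map-id (remaining j)))
  ... | D′ , e | r , r∈ , _ with rows-sound j (remaining j) s r∈
  ... | A , e′ , _ = D′ ++ map proj₁ A , trans e (trans (cong (D′ ++_) e′) (sym (++-assoc D′ _ _)))

  selection-sound : ∀ j (r : ℕ → Row) → (∀ {i} → i < j → r i ∈ rowsOf i) →
    ∃[ A ] D ≡ map proj₁ A ++ remaining j ×
           (∀ {i ℓ} → i < j → ℓ ∈ r i → ℓ ≡ i ⊎ Any (Covers ℓ) A)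
  selection-sound zero    r r∈ = [] , refl , λ ()
  selection-sound (suc j) r r∈
    with selection-sound j r (r∈ ∘ m≤n⇒m≤1+n) | rows-sound j (remaining j) s (r∈ ≤-refl)
  ... | A , e , f | B , e′ , g = A ++ B ,
    trans e (trans (cong (map proj₁ A ++_) e′)
      (trans (sym (++-assoc (map proj₁ A) _ _)) (cong (_++ remaining (suc j)) (sym (map-++ proj₁ A B))))) ,
    λ i<j ℓ∈ → h i<j ℓ∈
    where
    h : ∀ {i ℓ} → i < suc j → ℓ ∈ r i → ℓ ≡ i ⊎ Any (Covers ℓ) (A ++ B)
    h {i} i<j ℓ∈ with m≤n⇒m<n∨m≡n (s≤s⁻¹ i<j)
    h i<j ℓ∈ | inj₁ i<j′ with f i<j′ ℓ∈
    ... | inj₁ p = inj₁ p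
    ... | inj₂ p = inj₂ (Any.++⁺ˡ p)
    h i<j ℓ∈ | inj₂ refl with g ℓ∈
    ... | inj₁ p = inj₁ p
    ... | inj₂ p = inj₂ (Any.++⁺ʳ A p)

  module Selection (A : List (Decorated × Bool)) (A≡ : map proj₁ A ≡ D) where

    left : ∀ j → ∃[ A′ ] map proj₁ A′ ≡ remaining j
    left zero    = A , A≡
    left (suc j) with rows-complete j (remaining j) s (proj₁ (left j)) (proj₂ (left j))
    ... | _ , _ , _ , A′ , e , _ = A′ , e

    selected : ℕ → Row
    selected j = proj₁ (rows-complete j (remaining j) s (proj₁ (left j)) (proj₂ (left j)))

    selected-∈ : ∀ j → selected j ∈ rowsOf j
    selected-∈ j = proj₁ (proj₂ (rows-complete j (remaining j) s (proj₁ (left j)) (proj₂ (left j))))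

    ∈-selected : ∀ j → j ∈ selected j
    ∈-selected j = proj₁ (proj₂ (proj₂ (rows-complete j (remaining j) s (proj₁ (left j)) (proj₂ (left j)))))

    selected-covers : ∀ j {e} → e ∈ A →
      e ∈ proj₁ (left j) ⊎ (∃[ i ] i < j × (∀ {ℓ} → Covers ℓ e → ℓ ∈ selected i))
    selected-covers zero    e∈ = inj₁ e∈
    selected-covers (suc j) e∈ with selected-covers j e∈
    ... | inj₂ (i , i<j , f) = inj₂ (i , m≤n⇒m≤1+n i<j , f)
    ... | inj₁ e∈′ with proj₂ (proj₂ (proj₂ (proj₂ (proj₂
      (rows-complete j (remaining j) s (proj₁ (left j)) (proj₂ (left j))))))) e∈′
    ... | inj₁ e∈″ = inj₁ e∈″
    ... | inj₂ f   = inj₂ (j , ≤-refl , f)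

-- Block size

quotient-bound : ∀ k W → let s = ⟦ quotient ⟧ (suc k , W) in
                 length W ≤ suc k * s × suc k * s ≤ length W + k
quotient-bound k W with q W
  where
  st : List Slot → ℕ × ℕ
  st W = ⟦ fold quotientStep ⟧ (suc k , (W , (0 , 0)))
  -- The second component of the state counts the free places left in the last block.
  q : ∀ W → suc k * proj₁ (st W) ≡ length W + proj₂ (st W) × proj₂ (st W) ≤ k
  q []      = *-zeroʳ (suc k) , z≤n
  q (w ∷ W) with st W | q W
  ... | s , zero  | e , _ = trans (*-suc (suc k) s) (trans (cong (suc k +_) e)
    (cong suc (trans (cong (k +_) (+-identityʳ _)) (+-comm k (length W))))) , ≤-refl
  ... | s , suc r | e , r< = trans e (+-suc (length W) r) , <⇒≤ r<
... | e , r≤ = ≤-trans (m≤m+n _ _) (≤-reflexive (sym e)) , ≤-trans (≤-reflexive e) (+-monoʳ-≤ (length W) r≤)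

^-cancelˡ-≤ : ∀ k {a b} → a ^ suc k ≤ b ^ suc k → a ≤ b
^-cancelˡ-≤ k {a} {b} p with a ≤? b
... | yes q = q
... | no ¬q = ⊥-elim (<-irrefl refl (<-≤-trans (^-monoˡ-< (suc k) (≰⇒> ¬q)) p))

*-^ : ∀ a b k → (a * b) ^ k ≡ a ^ k * b ^ k
*-^ a b zero    = refl
*-^ a b (suc k) = trans (cong (a * b *_) (*-^ a b k)) (lem a b (a ^ k) (b ^ k))
  where
  lem : ∀ a b c d → a * b * (c * d) ≡ a * c * (b * d)
  lem = solve-∀

-- Rounding up adds less than one place for each block, at the price of a factor `2 ^ k`: `(2 ^ s) ^
-- k ≤ 2 ^ (formulaSize F + k) ≤ (2 * n) ^ k`, and the `k`-th power is cancelled. For `k = 0` the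
-- size bound leaves only the empty formula.
quotient-spec : ∀ {k n F} W → SizeBound k n F → length W ≤ formulaSize F →
                let s = ⟦ quotient ⟧ (k , W) in length W ≤ k * s × 2 ^ s ≤ 2 * n
quotient-spec {suc k} {n} {F} W (_ , 2^L≤) W≤ with quotient-bound k W
... | p , q = p , ^-cancelˡ-≤ k (begin
  (2 ^ s) ^ suc k               ≡⟨ ^-*-assoc 2 s (suc k) ⟩
  2 ^ (s * suc k)               ≡⟨ cong (2 ^_) (*-comm s (suc k)) ⟩
  2 ^ (suc k * s)               ≤⟨ ^-monoʳ-≤ 2 (≤-trans q (+-mono-≤ W≤ (n≤1+n k))) ⟩
  2 ^ (formulaSize F + suc k)   ≡⟨ ^-distribˡ-+-* 2 (formulaSize F) (suc k) ⟩
  2 ^ formulaSize F * 2 ^ suc k ≤⟨ *-monoˡ-≤ (2 ^ suc k) 2^L≤ ⟩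
  n ^ suc k * 2 ^ suc k         ≡⟨ sym (*-^ n 2 (suc k)) ⟩
  (n * 2) ^ suc k               ≡⟨ cong (_^ suc k) (*-comm n 2) ⟩
  (2 * n) ^ suc k               ∎)
  where
  open ≤-Reasoning
  s = ⟦ quotient ⟧ (suc k , W)
quotient-spec {zero} {n} {F} W (nz , 2^L≤1) W≤ with formulaSize F in eq
... | suc L = ⊥-elim (<-irrefl refl (≤-trans (^-monoʳ-≤ 2 {1} {suc L} (s≤s z≤n)) 2^L≤1))
... | zero with W | W≤
... | [] | z≤n = z≤n , ≤-trans (>-nonZero⁻¹ n {{nz}}) (m≤m+n n _)

-- Choices of one row from each block

module Cover {k n F} (bound : SizeBound k n F) where

  m : ℕ
  m = proj₁ (⟦ flatten ⟧ (F , k))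

  W : List Slot
  W = proj₂ (⟦ flatten ⟧ (F , k))

  N : Numbering k m F W
  N = flatten-numbering k F

  s : ℕ
  s = ⟦ quotient ⟧ (k , W)

  open Numbering N
  open Pieces s (⟦ decorate ⟧ W) public

  record RowCover : Set where
    field
      chosen   : ℕ → Row
      chosen-∈ : ∀ {i} → i < k → chosen i ∈ rowsOf i
      covers   : ∀ {u} → u < m → ∃[ i ] i < k × u ∈ chosen i

  s-spec : length W ≤ k * s × 2 ^ s ≤ 2 * n
  s-spec = quotient-spec {k} {n} {F} W bound length-≤

  pointers-length : ∀ l → length (pointers W l) ≡ length l
  pointers-length []      = refl
  pointers-length (w ∷ l) = cong suc (pointers-length l)

  decorate-length : length (⟦ decorate ⟧ W) ≡ length W
  decorate-length = trans (cong length (decorate-≡ W)) (trans (length-map ⟦ labels ⟧ (pointers W W)) (pointers-length W))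

  remaining-[] : remaining k ≡ []
  remaining-[] = length-0 (remaining k) (trans (remaining-length k)
    (m≤n⇒m∸n≡0 (≤-trans (≤-reflexive decorate-length) (proj₁ s-spec))))
    where
    length-0 : ∀ {A : Set} (l : List A) → length l ≡ 0 → l ≡ []
    length-0 [] _ = refl

  undecorate : ∀ (P : List (Slot × ℕ)) A → map ⟦ labels ⟧ P ≡ map proj₁ A →
               ∃[ E ] map proj₁ E ≡ P × map decorateEntry E ≡ A
  undecorate []      []            e = [] , refl , refl
  undecorate (p ∷ P) ((q , β) ∷ A) e with undecorate P A (∷-injectiveʳ e)
  ... | E , e₁ , e₂ = (p , β) ∷ E , cong (p ∷_) e₁ ,
    cong₂ (λ q A → (q , β) ∷ A) (∷-injectiveˡ e) e₂

  k≤m : k ≤ m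
  k≤m = subst (k ≤_) (sym size-≡) (m≤n+m k (formulaSize F))

  rowCover⇒satisfiable : RowCover → ∃[ α ] Satisfies α F
  rowCover⇒satisfiable R with selection-sound k (RowCover.chosen R) (RowCover.chosen-∈ R)
  ... | A , D≡ , f with undecorate (pointers W W) A (trans (sym (decorate-≡ W))
    (trans D≡ (trans (cong (map proj₁ A ++_) remaining-[]) (++-identityʳ _))))
  ... | E , E≡ , refl = readOff N E E≡ cover E , covers⇒satisfies N E E≡ cover
    where
    cover : ∀ u → k ≤ u → u < m → Any (CoversCases u) E
    cover u k≤u u<m with RowCover.covers R u<m
    ... | i , i<k , u∈ with f i<k u∈
    ... | inj₁ refl = ⊥-elim (<-irrefl refl (<-≤-trans i<k k≤u))
    ... | inj₂ p    = Any.map (λ {e} → covers-cases u e) (Any.map⁻ p)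

  satisfiable⇒rowCover : ∀ α → Satisfies α F → RowCover
  satisfiable⇒rowCover α sat = record
    { chosen   = selected
    ; chosen-∈ = λ {i} _ → selected-∈ i
    ; covers   = cover
    }
    where
    A : List (Decorated × Bool)
    A = map decorateEntry (assigned N α)
    A≡ : map proj₁ A ≡ ⟦ decorate ⟧ W
    A≡ = trans (sym (map-∘ (assigned N α))) (trans (sym (map-∘ (pointers W W))) (sym (decorate-≡ W)))
    open Selection A A≡
    left-[] : proj₁ (left k) ≡ []
    left-[] with proj₁ (left k) | trans (proj₂ (left k)) remaining-[]
    ... | [] | _ = refl
    cover : ∀ {u} → u < m → ∃[ i ] i < k × u ∈ selected i
    cover {u} u<m with u <? k
    ... | yes u<k = u , u<k , ∈-selected u
    ... | no u≮k with find (satisfies⇒covers N α sat u (≮⇒≥ u≮k) u<m)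
    ... | e , e∈ , c with selected-covers k (∈-map⁺ decorateEntry e∈)
    ... | inj₁ e∈′ with () ← subst (_ ∈_) left-[] e∈′
    ... | inj₂ (i , i<k , f) = i , i<k , f (cases-covers u e c)

  labels-bounds : ∀ {ℓ e} → proj₁ e ∈ pointers W W → CoversCases ℓ e → k ≤ ℓ × ℓ < m
  labels-bounds p∈ c with All.lookup (pointers-next W decreasing) p∈
  labels-bounds p∈ (inj₁ (_ , refl))        | w∈ , _ = All.lookup num-bounds w∈
  labels-bounds p∈ (inj₂ (inj₁ (_ , refl))) | _ , (v , v∈ , _ , refl) , _ = All.lookup num-bounds v∈
  labels-bounds p∈ (inj₂ (inj₂ (_ , refl))) | w∈ , _ = All.lookup header-bounds w∈

  -- In particular a label below `k` occurs only in its own block, which tells the block of a base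
  -- point from the labels it covers.
  rowsOf-labels : ∀ {u r ℓ} → r ∈ rowsOf u → ℓ ∈ r → ℓ ≡ u ⊎ (k ≤ ℓ × ℓ < m)
  rowsOf-labels {u} {r} {ℓ} r∈ ℓ∈ with Piece.rows-sound u (remaining u) s r∈
  ... | A , e , f with f ℓ∈
  ... | inj₁ p = inj₁ p
  ... | inj₂ p with find p | remaining-suffix u
  ... | (q , β) , e∈ , c | D′ , e′ with ∈-map⁻ ⟦ labels ⟧ (subst (q ∈_)
    (trans (sym (trans e′ (cong (D′ ++_) e))) (decorate-≡ W))
    (∈-++⁺ʳ D′ (∈-++⁺ˡ (∈-map⁺ proj₁ e∈))))
  ... | wq , wq∈ , refl = inj₂ (labels-bounds {e = wq , β} wq∈ (covers-cases ℓ (wq , β) c))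

  rowsOf-inhabited : ∀ u → ∃[ r ] r ∈ rowsOf u × u ∈ r
  rowsOf-inhabited u with Piece.rows-complete u (remaining u) s
    (map (_, false) (remaining u)) (trans (sym (map-∘ (remaining u))) (map-id (remaining u)))
  ... | r , r∈ , u∈ , _ = r , r∈ , u∈

-- Points as numbers: binary digits and row numbers

bit : Parity → ℕ → ℕ
bit 0ℙ y = y + y
bit 1ℙ y = suc (y + y)

half-bit : ∀ p y → ⌊ bit p y /2⌋ ≡ y
half-bit 0ℙ y = sym (n≡⌊n+n/2⌋ y)
half-bit 1ℙ zero    = refl
half-bit 1ℙ (suc y) = cong suc (trans (cong ⌊_/2⌋ (+-suc y y)) (half-bit 1ℙ y))

parity-bit : ∀ p y → parity (bit p y) ≡ p
parity-bit 0ℙ zero    = refl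
parity-bit 0ℙ (suc y) = trans (cong (parity ∘ suc) (+-suc y y)) (parity-bit 0ℙ y)
parity-bit 1ℙ zero    = refl
parity-bit 1ℙ (suc y) = trans (cong parity (+-suc y y)) (parity-bit 1ℙ y)

bit-parity-half : ∀ x → bit (parity x) ⌊ x /2⌋ ≡ x
bit-parity-half zero          = refl
bit-parity-half (suc zero)    = refl
bit-parity-half (suc (suc x)) = trans (lem (parity x) ⌊ x /2⌋) (cong (suc ∘ suc) (bit-parity-half x))
  where
  lem : ∀ p y → bit p (suc y) ≡ suc (suc (bit p y))
  lem 0ℙ y = cong suc (+-suc y y)
  lem 1ℙ y = cong (suc ∘ suc) (+-suc y y)

bit-injectiveˡ : ∀ {p q y z} → bit p y ≡ bit q z → p ≡ q
bit-injectiveˡ {p} {q} {y} {z} e = trans (sym (parity-bit p y)) (trans (cong parity e) (parity-bit q z))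

bit-injectiveʳ : ∀ {p q y z} → bit p y ≡ bit q z → y ≡ z
bit-injectiveʳ {p} {q} {y} {z} e = trans (sym (half-bit p y)) (trans (cong ⌊_/2⌋ e) (half-bit q z))

halves : ℕ → ℕ → ℕ
halves zero    x = x
halves (suc n) x = halves n ⌊ x /2⌋

half-<⁺ : ∀ {x n} → ⌊ x /2⌋ < n → x < n + n
half-<⁺ {x} {n} p with parity x | bit-parity-half x
... | 0ℙ | e = subst (_< n + n) e (+-mono-< p p)
... | 1ℙ | e = subst (_< n + n) e (≤-trans (≤-reflexive (cong suc (sym (+-suc ⌊ x /2⌋ ⌊ x /2⌋)))) (+-mono-≤ p p))

half-<⁻ : ∀ {x n} → x < n + n → ⌊ x /2⌋ < n
half-<⁻ {x} {n} p with ⌊ x /2⌋ <? n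
... | yes q = q
... | no ¬q = ⊥-elim (<-irrefl refl (<-≤-trans p (≤-trans (+-mono-≤ (≮⇒≥ ¬q) (≮⇒≥ ¬q))
  (subst (⌊ x /2⌋ + ⌊ x /2⌋ ≤_) (bit-parity-half x) (lem (parity x) ⌊ x /2⌋)))))
  where
  lem : ∀ p y → y + y ≤ bit p y
  lem 0ℙ y = ≤-refl
  lem 1ℙ y = n≤1+n _

*2^suc : ∀ R n → R * 2 ^ suc n ≡ R * 2 ^ n + R * 2 ^ n
*2^suc R n = lem R (2 ^ n)
  where
  lem : ∀ a b → a * (2 * b) ≡ a * b + a * b
  lem = solve-∀

halves-<⁺ : ∀ n {x R} → halves n x < R → x < R * 2 ^ n
halves-<⁺ zero    {x} {R} p = subst (x <_) (sym (*-identityʳ R)) p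
halves-<⁺ (suc n) {x} {R} p = subst (x <_) (sym (*2^suc R n)) (half-<⁺ (halves-<⁺ n p))

halves-<⁻ : ∀ n {x R} → x < R * 2 ^ n → halves n x < R
halves-<⁻ zero    {x} {R} p = subst (x <_) (*-identityʳ R) p
halves-<⁻ (suc n) {x} {R} p = halves-<⁻ n (half-<⁻ (subst (x <_) (*2^suc R n) p))

halves-*2^ : ∀ n i → halves n (i * 2 ^ n) ≡ i
halves-*2^ zero    i = *-identityʳ i
halves-*2^ (suc n) i = trans (cong (halves n) (trans (cong ⌊_/2⌋ (*2^suc i n)) (sym (n≡⌊n+n/2⌋ (i * 2 ^ n)))))
                             (halves-*2^ n i)

-- g flips the bits of x at the positions whose label ℓ has g ℓ ≡ 1ℙ; the head of the row labels the lowest bit.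

act : (ℕ → Parity) → Row → ℕ → ℕ
act g []      x = x
act g (ℓ ∷ r) x = bit (parity x ⊕ g ℓ) (act g r ⌊ x /2⌋)

halves-act : ∀ g r x → halves (length r) (act g r x) ≡ halves (length r) x
halves-act g []      x = refl
halves-act g (ℓ ∷ r) x = trans (cong (halves (length r)) (half-bit (parity x ⊕ g ℓ) _)) (halves-act g r ⌊ x /2⌋)

act-⊕ : ∀ g h r x → act h r (act g r x) ≡ act (λ ℓ → g ℓ ⊕ h ℓ) r x
act-⊕ g h []      x = refl
act-⊕ g h (ℓ ∷ r) x = cong₂ bit
  (trans (cong (_⊕ h ℓ) (parity-bit (parity x ⊕ g ℓ) _)) (ℙ.+-assoc (parity x) (g ℓ) (h ℓ)))
  (trans (cong (act h r) (half-bit (parity x ⊕ g ℓ) _)) (act-⊕ g h r ⌊ x /2⌋))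

act-cong : ∀ {g h} r x → (∀ {ℓ} → ℓ ∈ r → g ℓ ≡ h ℓ) → act g r x ≡ act h r x
act-cong []      x e = refl
act-cong (ℓ ∷ r) x e = cong₂ (λ p y → bit (parity x ⊕ p) y) (e (here refl)) (act-cong r ⌊ x /2⌋ (e ∘ there))

act-0 : ∀ r x → act (λ _ → 0ℙ) r x ≡ x
act-0 []      x = refl
act-0 (ℓ ∷ r) x = trans (cong₂ bit (ℙ.+-identityʳ (parity x)) (act-0 r ⌊ x /2⌋)) (bit-parity-half x)

-- The action on a row is by translations, so the image of a single point determines all coordinates
-- that the row sees.
act-injective : ∀ g h r x → act g r x ≡ act h r x → ∀ {ℓ} → ℓ ∈ r → g ℓ ≡ h ℓ
act-injective g h (ℓ ∷ r) x e (here refl) = ℙ.+-cancelˡ-≡ (parity x) (g ℓ) (h ℓ) (bit-injectiveˡ e)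
act-injective g h (ℓ ∷ r) x e (there ℓ∈)  =
  act-injective g h r ⌊ x /2⌋ (bit-injectiveʳ {parity x ⊕ g ℓ} {parity x ⊕ h ℓ} e) ℓ∈

-- Rows are numbered from the end of the list, the order in which the right fold in `table` meets
-- them.
rowAt : List Row → ℕ → Row
rowAt []       i = []
rowAt (r ∷ rs) i = ifᵇ does (i ≟ length rs) then r else rowAt rs i

rowAt-∈ : ∀ rs {i} → i < length rs → rowAt rs i ∈ rs
rowAt-∈ (r ∷ rs) {i} i< with i ≡ᵇ length rs | proof (i ≟ length rs)
... | true  | _      = here refl
... | false | ofⁿ ¬e = there (rowAt-∈ rs (≤∧≢⇒< (s≤s⁻¹ i<) ¬e))

rowAt-onto : ∀ rs {r} → r ∈ rs → ∃[ i ] i < length rs × rowAt rs i ≡ r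
rowAt-onto (r ∷ rs) (here refl) = length rs , ≤-refl ,
  cong (λ c → ifᵇ c then r else rowAt rs (length rs)) (dec-true (length rs ≟ length rs) refl)
rowAt-onto (r ∷ rs) (there r∈) with rowAt-onto rs r∈
... | i , i< , e = i , m≤n⇒m≤1+n i< ,
  trans (cong (λ c → ifᵇ c then r else rowAt rs i) (dec-false (i ≟ length rs) (<⇒≢ i<))) e

unit : ℕ → ℕ → Parity
unit u ℓ = ifᵇ does (u ≟ ℓ) then 1ℙ else 0ℙ

unit-self : ∀ u → unit u u ≡ 1ℙ
unit-self u = cong (λ c → ifᵇ c then 1ℙ else 0ℙ) (dec-true (u ≟ u) refl)

unit-other : ∀ {u ℓ} → ℓ ≢ u → unit u ℓ ≡ 0ℙ
unit-other {u} {ℓ} ¬e = cong (λ c → ifᵇ c then 1ℙ else 0ℙ) (dec-false (u ≟ ℓ) (¬e ∘ sym))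

-- The permutation group given by a list of rows

module Action (D : ℕ) (rows : List Row) (row-length : ∀ {r} → r ∈ rows → length r ≡ D) where

  points : ℕ
  points = length rows * 2 ^ D

  rowOf : ℕ → Row
  rowOf x = rowAt rows (halves D x)

  image : (ℕ → Parity) → ℕ → ℕ
  image g x = act g (rowOf x) x

  rowOf-∈ : ∀ {x} → x < points → rowOf x ∈ rows
  rowOf-∈ x< = rowAt-∈ rows (halves-<⁻ D x<)

  halves-image : ∀ g {x} → x < points → halves D (image g x) ≡ halves D x
  halves-image g {x} x< = subst (λ n → halves n (image g x) ≡ halves n x)
    (row-length (rowOf-∈ x<)) (halves-act g (rowOf x) x)

  image-< : ∀ g {x} → x < points → image g x < points
  image-< g {x} x< = halves-<⁺ D (subst (_< length rows) (sym (halves-image g x<)) (halves-<⁻ D x<))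

  image-⊕ : ∀ g h {x} → x < points → image h (image g x) ≡ image (λ ℓ → g ℓ ⊕ h ℓ) x
  image-⊕ g h {x} x< = trans (cong (λ i → act h (rowAt rows i) (image g x)) (halves-image g x<))
                             (act-⊕ g h (rowOf x) x)

  image-involutive : ∀ g {x} → x < points → image g (image g x) ≡ x
  image-involutive g {x} x< = trans (image-⊕ g g x<)
    (trans (act-cong (rowOf x) x (λ {ℓ} _ → ℙ.p+p≡0ℙ (g ℓ))) (act-0 (rowOf x) x))

  -- Unfolding perm would expose the proofs in it, which are slow to normalise.
  abstract
    perm : (ℕ → Parity) → Permutation′ points
    perm g = permutation f f f-involutive f-involutive
      where
      f : Fin points → Fin points
      f x = fromℕ< (image-< g (toℕ<n x))
      f-involutive : ∀ x → f (f x) ≡ x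
      f-involutive x = toℕ-injective (trans (toℕ-fromℕ< _)
        (trans (cong (image g) (toℕ-fromℕ< _)) (image-involutive g (toℕ<n x))))

    toℕ-perm : ∀ g x → toℕ (perm g ⟨$⟩ʳ x) ≡ image g (toℕ x)
    toℕ-perm g x = toℕ-fromℕ< _

  perm-⊕ : ∀ g h x → perm h ⟨$⟩ʳ (perm g ⟨$⟩ʳ x) ≡ perm (λ ℓ → g ℓ ⊕ h ℓ) ⟨$⟩ʳ x
  perm-⊕ g h x = toℕ-injective (trans (toℕ-perm h (perm g ⟨$⟩ʳ x))
    (trans (cong (image h) (toℕ-perm g x))
      (trans (image-⊕ g h (toℕ<n x)) (sym (toℕ-perm (λ ℓ → g ℓ ⊕ h ℓ) x)))))

  perm-involutive : ∀ g x → perm g ⟨$⟩ʳ (perm g ⟨$⟩ʳ x) ≡ x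
  perm-involutive g x = toℕ-injective (trans (toℕ-perm g (perm g ⟨$⟩ʳ x))
    (trans (cong (image g) (toℕ-perm g x)) (image-involutive g (toℕ<n x))))

  generators : ℕ → Generators points
  generators m = map (perm ∘ unit) (downFrom m)

  pointOf : ∀ {r} → r ∈ rows → ∃[ x ] rowOf (toℕ {points} x) ≡ r
  pointOf r∈ with rowAt-onto rows r∈
  ... | i , i< , e = fromℕ< x< , trans (cong (rowAt rows)
      (trans (cong (halves D) (toℕ-fromℕ< x<)) (halves-*2^ D i))) e
    where
    x< : i * 2 ^ D < points
    x< = halves-<⁺ D (subst (_< length rows) (sym (halves-*2^ D i)) i<)

  perm-injective : ∀ g h x → perm g ⟨$⟩ʳ x ≡ perm h ⟨$⟩ʳ x → ∀ {ℓ} → ℓ ∈ rowOf (toℕ x) → g ℓ ≡ h ℓ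
  perm-injective g h x e = act-injective g h (rowOf (toℕ x)) (toℕ x)
    (trans (sym (toℕ-perm g x)) (trans (cong toℕ e) (toℕ-perm h x)))

  perm-cong : ∀ {g h} x → (∀ {ℓ} → ℓ ∈ rowOf (toℕ x) → g ℓ ≡ h ℓ) → perm g ⟨$⟩ʳ x ≡ perm h ⟨$⟩ʳ x
  perm-cong {g} {h} x e = toℕ-injective (trans (toℕ-perm g x)
    (trans (act-cong (rowOf (toℕ x)) (toℕ x) e) (sym (toℕ-perm h x))))

  perm-0 : ∀ x → perm (λ _ → 0ℙ) ⟨$⟩ʳ x ≡ x
  perm-0 x = toℕ-injective (trans (toℕ-perm (λ _ → 0ℙ) x) (act-0 (rowOf (toℕ x)) (toℕ x)))

  module Elements (m : ℕ) (occurs : ∀ {u} → u < m → ∃[ r ] r ∈ rows × u ∈ r) where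

    A : Generators points
    A = generators m

    occursAt : ∀ {u} → u < m → ∃[ x ] u ∈ rowOf (toℕ {points} x)
    occursAt {u} u<m = let r , r∈ , u∈ = occurs u<m ; x , x≡ = pointOf r∈ in x , subst (u ∈_) (sym x≡) u∈

    -- The vector is read off the derivation and not off the permutation; `coefficient-cong` shows
    -- that below `m` it depends on the permutation only. An inverse keeps its vector because every
    -- vector is its own negative.
    coefficient : ∀ {π} → Generated A π → ℕ → Parity
    coefficient (gen π∈)   = unit (proj₁ (∈-map⁻ (perm ∘ unit) π∈))
    coefficient id         = λ _ → 0ℙ
    coefficient (comp p q) = λ ℓ → coefficient p ℓ ⊕ coefficient q ℓ
    coefficient (inv p)    = coefficient p
    coefficient (resp _ p) = coefficient p

    coefficient-≈ : ∀ {π} (p : Generated A π) → π ≈ perm (coefficient p)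
    coefficient-≈ (gen π∈) x = cong (_⟨$⟩ʳ x) (proj₂ (proj₂ (∈-map⁻ (perm ∘ unit) π∈)))
    coefficient-≈ id       x = sym (perm-0 x)
    coefficient-≈ (comp {π} {ρ} p q) x = trans (coefficient-≈ q (π ⟨$⟩ʳ x))
      (trans (cong (perm (coefficient q) ⟨$⟩ʳ_) (coefficient-≈ p x))
        (perm-⊕ (coefficient p) (coefficient q) x))
    coefficient-≈ (inv {π} p) x = trans (sym (perm-involutive (coefficient p) _))
      (cong (perm (coefficient p) ⟨$⟩ʳ_) (trans (sym (coefficient-≈ p (π ⟨$⟩ˡ x))) (Perm.inverseʳ π)))
    coefficient-≈ (resp π≈ρ p) x = trans (sym (π≈ρ x)) (coefficient-≈ p x)

    coefficient-≥m : ∀ {π} (p : Generated A π) {ℓ} → m ≤ ℓ → coefficient p ℓ ≡ 0ℙ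
    coefficient-≥m (gen π∈) m≤ℓ = let u , u∈ , _ = ∈-map⁻ (perm ∘ unit) π∈ in
      unit-other {u} (λ ℓ≡u → <-irrefl (sym ℓ≡u) (<-≤-trans (∈-downFrom⁻ u∈) m≤ℓ))
    coefficient-≥m id         m≤ℓ = refl
    coefficient-≥m (comp p q) m≤ℓ = cong₂ _⊕_ (coefficient-≥m p m≤ℓ) (coefficient-≥m q m≤ℓ)
    coefficient-≥m (inv p)    m≤ℓ = coefficient-≥m p m≤ℓ
    coefficient-≥m (resp _ p) m≤ℓ = coefficient-≥m p m≤ℓ

    -- This is faithfulness: some point has `u` in its row, and its image determines the coordinate
    -- at `u`.
    coefficient-cong : ∀ {π ρ} (p : Generated A π) (q : Generated A ρ) → π ≈ ρ →
                       ∀ {u} → u < m → coefficient p u ≡ coefficient q u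
    coefficient-cong p q π≈ρ u<m = let x , u∈ = occursAt u<m in
      perm-injective (coefficient p) (coefficient q) x
        (trans (sym (coefficient-≈ p x)) (trans (π≈ρ x) (coefficient-≈ q x))) u∈

    coefficient-injective : ∀ {π ρ} (p : Generated A π) (q : Generated A ρ) →
      (∀ {u} → u < m → coefficient p u ≡ coefficient q u) → π ≈ ρ
    coefficient-injective p q e x = trans (coefficient-≈ p x)
      (trans (perm-cong x λ {ℓ} _ → eq ℓ) (sym (coefficient-≈ q x)))
      where
      eq : ∀ ℓ → coefficient p ℓ ≡ coefficient q ℓ
      eq ℓ with ℓ <? m
      ... | yes ℓ<m = e ℓ<m
      ... | no ℓ≮m  = trans (coefficient-≥m p (≮⇒≥ ℓ≮m)) (sym (coefficient-≥m q (≮⇒≥ ℓ≮m)))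

    generator : ∀ {u} → u < m → Generated A (perm (unit u))
    generator u<m = gen (∈-map⁺ (perm ∘ unit) (∈-downFrom⁺ u<m))

    -- `coefficient` takes its label from `∈-map⁻`, which need not reduce to `u`; the two vectors
    -- are compared through their action instead.
    coefficient-generator : ∀ {u} (u<m : u < m) {ℓ} → ℓ < m → coefficient (generator u<m) ℓ ≡ unit u ℓ
    coefficient-generator {u} u<m ℓ<m = let x , ℓ∈ = occursAt ℓ<m in
      sym (perm-injective (unit u) (coefficient (generator u<m)) x
        (coefficient-≈ (generator u<m) x) ℓ∈)

    -- Surjectivity onto F₂^m: the generators at the coordinates where `g` is odd are multiplied up
    -- one at a time.
    withCoefficients : (g : Fin m → Parity) → ∀ j → j ≤ m → ∃[ π ] Σ[ p ∈ Generated A π ]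
      (∀ i → (toℕ i < j → coefficient p (toℕ i) ≡ g i) × (j ≤ toℕ i → coefficient p (toℕ i) ≡ 0ℙ))
    withCoefficients g zero    _   = Perm.id , id , λ i → (λ ()) , λ _ → refl
    withCoefficients g (suc j) j<m with withCoefficients g j (<⇒≤ j<m) | g (fromℕ< j<m) in gj
    ... | π , p , f | 0ℙ = π , p , λ i → below i , proj₂ (f i) ∘ <⇒≤
      where
      below : ∀ i → toℕ i < suc j → coefficient p (toℕ i) ≡ g i
      below i i<sj with m≤n⇒m<n∨m≡n (s≤s⁻¹ i<sj)
      ... | inj₁ i<j = proj₁ (f i) i<j
      ... | inj₂ i≡j = trans (proj₂ (f i) (≤-reflexive (sym i≡j)))
        (trans (sym gj) (cong g (toℕ-injective (trans (toℕ-fromℕ< j<m) (sym i≡j)))))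
    ... | π , p , f | 1ℙ = π ∘ₚ perm (unit j) , comp p (generator j<m) , λ i → below i , above i
      where
      value : ∀ i → coefficient p (toℕ i) ⊕ coefficient (generator j<m) (toℕ i) ≡
                    coefficient p (toℕ i) ⊕ unit j (toℕ i)
      value i = cong (coefficient p (toℕ i) ⊕_) (coefficient-generator j<m (toℕ<n i))
      below : ∀ i → toℕ i < suc j → _ ≡ g i
      below i i<sj with m≤n⇒m<n∨m≡n (s≤s⁻¹ i<sj)
      ... | inj₁ i<j = trans (value i) (trans (cong₂ _⊕_ (proj₁ (f i) i<j) (unit-other (<⇒≢ i<j)))
                                              (ℙ.+-identityʳ (g i)))
      ... | inj₂ i≡j = trans (value i) (trans (cong₂ _⊕_ (proj₂ (f i) (≤-reflexive (sym i≡j)))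
                                (trans (cong (unit j) i≡j) (unit-self j)))
        (trans (sym gj) (cong g (toℕ-injective (trans (toℕ-fromℕ< j<m) (sym i≡j))))))
      above : ∀ i → suc j ≤ toℕ i → _ ≡ 0ℙ
      above i j<i = trans (value i) (cong₂ _⊕_ (proj₂ (f i) (<⇒≤ j<i)) (unit-other (>⇒≢ j<i)))

    isElementary2 : IsElementary2Group (generatedGroup A)
    isElementary2 = m , (λ (_ , p) i → coefficient p (toℕ i)) , record
      { isGroupMonomorphism = record
        { isGroupHomomorphism = record
          { isMonoidHomomorphism = record
            { isMagmaHomomorphism = record
              { isRelHomomorphism = record
                { cong = λ { {_ , p} {_ , q} π≈ρ i → coefficient-cong p q π≈ρ (toℕ<n i) } }
              ; homo = λ _ _ _ → refl
              }
            ; ε-homo = λ _ → refl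
            }
          ; ⁻¹-homo = λ _ _ → refl
          }
        ; injective = λ { {_ , p} {_ , q} e → coefficient-injective p q λ u<m →
            subst (λ u → coefficient p u ≡ coefficient q u) (toℕ-fromℕ< u<m) (e (fromℕ< u<m)) }
        }
      ; surjective = λ g → let π , p , f = withCoefficients g m ≤-refl in
          (π , p) , λ { {_ , q} ρ≈π i →
            trans (coefficient-cong q p ρ≈π (toℕ<n i)) (proj₁ (f i) (toℕ<n i)) }
      }

    -- If no point of `S` had `u` in its row, the generator `unit u` would fix `S` pointwise, and
    -- yet it moves every point whose row contains `u`.
    base⇒covers : ∀ S → IsBase A S → ∀ {u} → u < m → ∃[ x ] x ∈ˢ S × u ∈ rowOf (toℕ x)
    base⇒covers S base {u} u<m with any? (λ x → (x ∈ˢ? S) ×-dec (u ∈? rowOf (toℕ x)))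
    ... | yes p = p
    ... | no ¬p = let x , u∈ = occursAt u<m in ⊥-elim (1≢0 (trans (sym (unit-self u))
      (perm-injective (unit u) (λ _ → 0ℙ) x (trans (fixes x) (sym (perm-0 x))) u∈)))
      where
      1≢0 : 1ℙ ≢ 0ℙ
      1≢0 ()
      fixes : perm (unit u) ≈ Perm.id
      fixes = base (perm (unit u)) (generator u<m) λ y y∈ →
        trans (perm-cong y λ ℓ∈ → unit-other {u} λ { refl → ¬p (y , y∈ , ℓ∈) }) (perm-0 y)

    covers⇒base : ∀ S → (∀ {u} → u < m → ∃[ x ] x ∈ˢ S × u ∈ rowOf (toℕ x)) → IsBase A S
    covers⇒base S covers π p fixes x = coefficient-injective p id zeros x
      where
      zeros : ∀ {u} → u < m → coefficient p u ≡ 0ℙ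
      zeros u<m = let x , x∈ , u∈ = covers u<m in
        perm-injective (coefficient p) (λ _ → 0ℙ) x
          (trans (sym (coefficient-≈ p x)) (trans (fixes x x∈) (sym (perm-0 x)))) u∈

-- Tables

range : ℕ → ℕ → List ℕ
range a zero    = []
range a (suc n) = a ∷ range (suc a) n

range-++ : ∀ a n n′ → range a n ++ range (a + n) n′ ≡ range a (n + n′)
range-++ a zero    n′ = cong (λ a → range a n′) (+-identityʳ a)
range-++ a (suc n) n′ = cong (a ∷_) (trans (cong (λ b → range (suc a) n ++ range b n′) (+-suc a n))
                                           (range-++ (suc a) n n′))

range-bounds : ∀ a n → All (λ x → a ≤ x × x < a + n) (range a n)
range-bounds a zero    = []
range-bounds a (suc n) = (≤-refl , ≤-trans (s≤s (m≤m+n a n)) (≤-reflexive (sym (+-suc a n)))) ∷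
  All.map (λ (p , q) → <⇒≤ p , ≤-trans q (≤-reflexive (sym (+-suc a n)))) (range-bounds (suc a) n)

range-length : ∀ a n → length (range a n) ≡ n
range-length a zero    = refl
range-length a (suc n) = cong suc (range-length (suc a) n)

tabulate-range : ∀ (h : ℕ → ℕ) a n → tabulate {n = n} (λ i → h (a + toℕ i)) ≡ map h (range a n)
tabulate-range h a zero    = refl
tabulate-range h a (suc n) = cong₂ _∷_ (cong h (+-identityʳ a))
  (trans (tabulate-cong (λ i → cong h (+-suc a (toℕ i)))) (tabulate-range h (suc a) n))

doubles : List ℕ → List ℕ
doubles []       = []
doubles (y ∷ ys) = bit 0ℙ y ∷ bit 1ℙ y ∷ doubles ys

doubles-range : ∀ a n → doubles (range a n) ≡ range (a + a) (n + n)
doubles-range a zero    = refl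
doubles-range a (suc n) = trans (cong (λ l → a + a ∷ suc (a + a) ∷ l)
    (trans (doubles-range (suc a) n) (cong (λ b → range (suc b) (n + n)) (+-suc a a))))
  (cong (λ k → range (a + a) (suc k)) (sym (+-suc n n)))

twist : Parity → List ℕ → List ℕ
twist p []       = []
twist p (y ∷ ys) = bit p y ∷ bit (1ℙ ⊕ p) y ∷ twist p ys

splitPoints-≡ : ∀ c ys → ⟦ fold splitPoint ⟧ (c , (ys , [])) ≡ twist (ifᵇ c then 1ℙ else 0ℙ) ys
splitPoints-≡ c     []       = refl
splitPoints-≡ true  (y ∷ ys) = cong₂ (λ d l → suc d ∷ d ∷ l) (double-≡ y) (splitPoints-≡ true ys)
splitPoints-≡ false (y ∷ ys) = cong₂ (λ d l → d ∷ suc d ∷ l) (double-≡ y) (splitPoints-≡ false ys)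

-- The square behind the induction in `expand-≡`: acting and then refining by a possibly flipped
-- lowest bit is the same as refining first and acting with one more label.
twist-map : ∀ g ℓ r ys → twist (g ℓ) (map (act g r) ys) ≡ map (act g (ℓ ∷ r)) (doubles ys)
twist-map g ℓ r []       = refl
twist-map g ℓ r (y ∷ ys) = cong₂ _∷_ (point 0ℙ) (cong₂ _∷_ (point 1ℙ) (twist-map g ℓ r ys))
  where
  point : ∀ p → bit (p ⊕ g ℓ) (act g r y) ≡ act g (ℓ ∷ r) (bit p y)
  point p = sym (cong₂ (λ q x → bit (q ⊕ g ℓ) (act g r x)) (parity-bit p y) (half-bit p y))

expandStep-≡ : ∀ u ℓ ys → ⟦ expandStep ⟧ (u , (ℓ , ys)) ≡ twist (unit u ℓ) ys
expandStep-≡ u ℓ ys = trans (splitPoints-≡ (⟦ equal ⟧ (u , ℓ)) ys)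
  (cong (λ c → twist (ifᵇ c then 1ℙ else 0ℙ) ys) (equal-≡ u ℓ))

expand-≡ : ∀ u r i → ⟦ expand ⟧ (u , (r , i)) ≡
           map (act (unit u) r) (range (i * 2 ^ length r) (2 ^ length r))
expand-≡ u []      i = cong (_∷ []) (sym (*-identityʳ i))
expand-≡ u (ℓ ∷ r) i = trans (expandStep-≡ u ℓ (⟦ expand ⟧ (u , (r , i))))
  (trans (cong (twist (unit u ℓ)) (expand-≡ u r i))
    (trans (twist-map (unit u) ℓ r (range (i * P) P))
      (cong (map (act (unit u) (ℓ ∷ r))) (trans (doubles-range (i * P) P)
        (cong₂ range (sym (*2^suc i (length r))) (cong (P +_) (sym (+-identityʳ P))))))))
  where
  P = 2 ^ length r

map-cong-All : ∀ {f g : ℕ → ℕ} {P : ℕ → Set} {l} → All P l → (∀ {x} → P x → f x ≡ g x) → map f l ≡ map g l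
map-cong-All []       e = refl
map-cong-All (p ∷ ps) e = cong₂ _∷_ (e p) (map-cong-All ps e)

tableState : ℕ → List Row → ℕ × List ℕ
tableState u rows = ⟦ fold tableStep ⟧ (u , (rows , (0 , [])))

tableState-≡ : ∀ D u rows → (∀ {r} → r ∈ rows → length r ≡ D) → tableState u rows ≡
  (length rows , map (λ x → act (unit u) (rowAt rows (halves D x)) x) (range 0 (length rows * 2 ^ D)))
tableState-≡ D u []         _  = refl
tableState-≡ D u (r ∷ rows) len with tableState u rows | tableState-≡ D u rows (len ∘ there)
... | _ | refl = cong (suc (length rows) ,_) (trans
  (append-≡ {nat} (map image (range 0 (R * P))) _)
  (trans (cong₂ _++_
      (map-cong-All (range-bounds 0 (R * P)) below)
      (trans (expand-≡ u r R) (trans (cong (λ n → map (act (unit u) r) (range (R * 2 ^ n) (2 ^ n))) (len (here refl)))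
        (map-cong-All (range-bounds (R * P) P) above))))
    (trans (sym (map-++ image′ (range 0 (R * P)) _)) (cong (map image′)
      (trans (range-++ 0 (R * P) P) (cong (range 0) (+-comm (R * P) P)))))))
  where
  R = length rows
  P = 2 ^ D
  image image′ : ℕ → ℕ
  image x  = act (unit u) (rowAt rows (halves D x)) x
  image′ x = act (unit u) (rowAt (r ∷ rows) (halves D x)) x
  below : ∀ {x} → 0 ≤ x × x < R * P → image x ≡ image′ x
  below {x} (_ , x<) = cong (λ c → act (unit u) (ifᵇ c then r else rowAt rows (halves D x)) x)
    (sym (dec-false (halves D x ≟ R) (<⇒≢ (halves-<⁻ D x<))))
  above : ∀ {x} → R * P ≤ x × x < R * P + P → act (unit u) r x ≡ image′ x
  above {x} (x≥ , x<) = cong (λ c → act (unit u) (ifᵇ c then r else rowAt rows (halves D x)) x)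
    (sym (dec-true (halves D x ≟ R) (≤-antisym
      (s≤s⁻¹ (halves-<⁻ D {x} {suc R} (subst (x <_) (+-comm (R * P) P) x<)))
      (≮⇒≥ λ h< → <-irrefl refl (<-≤-trans (halves-<⁺ D h<) x≥)))))

tables-≡ : ∀ U rows → ⟦ tables ⟧ (U , rows) ≡ map (λ u → ⟦ table ⟧ (u , rows)) U
tables-≡ []      rows = refl
tables-≡ (u ∷ U) rows = cong (⟦ table ⟧ (u , rows) ∷_) (tables-≡ U rows)

permTable : ∀ {n} → Permutation′ n → List ℕ
permTable π = map toℕ (tabulate (π ⟨$⟩ʳ_))

generatorsValue : ∀ {n} → Generators n → ℕ × List (List ℕ)
generatorsValue {n} A = n , map permTable A

codeGenerators-≡ : ∀ {n} (A : Generators n) →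
                   codeGenerators A ≡ code (nat ⊗ list (list nat)) (generatorsValue A)
codeGenerators-≡ {n} A = cong (codeℕ n ∙_) (perms A)
  where
  points-≡ : ∀ l → codeList (codeℕ ∘ toℕ {n}) l ≡ codeList codeℕ (map toℕ l)
  points-≡ []      = refl
  points-≡ (i ∷ l) = cong (codeℕ (toℕ i) ∙_) (points-≡ l)
  perms : ∀ A → codeList codePermutation A ≡ codeList (codeList codeℕ) (map permTable A)
  perms []      = refl
  perms (π ∷ A) = cong₂ _∙_ (points-≡ (tabulate (π ⟨$⟩ʳ_))) (perms A)

module _ (D : ℕ) (rows : List Row) (row-length : ∀ {r} → r ∈ rows → length r ≡ D) where
  open Action D rows row-length

  table-≡ : ∀ u → ⟦ table ⟧ (u , rows) ≡ permTable (perm (unit u))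
  table-≡ u = trans (cong proj₂ (tableState-≡ D u rows row-length))
    (sym (trans (map-tabulate (perm (unit u) ⟨$⟩ʳ_) toℕ)
      (trans (tabulate-cong (toℕ-perm (unit u))) (tabulate-range (image (unit u)) 0 points))))

  table-length : ∀ u → length (⟦ table ⟧ (u , rows)) ≡ points
  table-length u = trans (cong (length ∘ proj₂) (tableState-≡ D u rows row-length))
    (trans (length-map _ (range 0 points)) (range-length 0 points))

  emit-≡ : ∀ m → ⟦ emit ⟧ (downFrom m , rows) ≡ generatorsValue (generators m)
  emit-≡ m = cong₂ _,_ (trans (len-≡ {nat} (⟦ table ⟧ (0 , rows))) (table-length 0))
    (trans (tables-≡ (downFrom m) rows) (trans (map-cong table-≡ (downFrom m)) (map-∘ (downFrom m))))

-- Cardinalities of subsets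

injection-≤ : ∀ {j n} (S : Subset n) (f : Fin j → Fin n) → (∀ {a b} → f a ≡ f b → a ≡ b) →
              (∀ i → f i ∈ˢ S) → j ≤ ∣ S ∣
injection-≤ {zero}  S f inj f∈ = z≤n
injection-≤ {suc j} S f inj f∈ = ≤-trans (s≤s (injection-≤ (S - f fzero) (f ∘ fsuc)
    (Fin.suc-injective ∘ inj)
    (λ i → x∈p∧x≢y⇒x∈p-y (f∈ (fsuc i)) (λ e → Fin.0≢1+n (inj (sym e))))))
  (x∈p⇒∣p-x∣<∣p∣ (f∈ fzero))

insert : ∀ {n} → Fin n → Subset n → Subset n
insert fzero    (_ Vec.∷ p) = inside Vec.∷ p
insert (fsuc i) (b Vec.∷ p) = b Vec.∷ insert i p

∈-insert : ∀ {n} i (p : Subset n) → i ∈ˢ insert i p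
∈-insert fzero    (_ Vec.∷ p) = Vec.here
∈-insert (fsuc i) (_ Vec.∷ p) = Vec.there (∈-insert i p)

insert-⊇ : ∀ {n} i {p : Subset n} {j} → j ∈ˢ p → j ∈ˢ insert i p
insert-⊇ fzero    Vec.here       = Vec.here
insert-⊇ fzero    (Vec.there j∈) = Vec.there j∈
insert-⊇ (fsuc i) Vec.here       = Vec.here
insert-⊇ (fsuc i) (Vec.there j∈) = Vec.there (insert-⊇ i j∈)

∣insert∣≤ : ∀ {n} i (p : Subset n) → ∣ insert i p ∣ ≤ suc ∣ p ∣
∣insert∣≤ fzero    (true  Vec.∷ p) = n≤1+n _
∣insert∣≤ fzero    (false Vec.∷ p) = ≤-refl
∣insert∣≤ (fsuc i) (true  Vec.∷ p) = s≤s (∣insert∣≤ i p)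
∣insert∣≤ (fsuc i) (false Vec.∷ p) = ∣insert∣≤ i p

imageOf : ∀ {j n} → (Fin j → Fin n) → Subset n
imageOf {zero}  f = ⊥
imageOf {suc j} f = insert (f fzero) (imageOf (f ∘ fsuc))

∈-imageOf : ∀ {j n} (f : Fin j → Fin n) i → f i ∈ˢ imageOf f
∈-imageOf f fzero    = ∈-insert (f fzero) (imageOf (f ∘ fsuc))
∈-imageOf f (fsuc i) = insert-⊇ (f fzero) (∈-imageOf (f ∘ fsuc) i)

∣imageOf∣≤ : ∀ {j n} (f : Fin j → Fin n) → ∣ imageOf f ∣ ≤ j
∣imageOf∣≤ {zero}  {n} f = ≤-reflexive (∣⊥∣≡0 n)
∣imageOf∣≤ {suc j} f = ≤-trans (∣insert∣≤ (f fzero) (imageOf (f ∘ fsuc))) (s≤s (∣imageOf∣≤ (f ∘ fsuc)))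

∣imageOf∣ : ∀ {j n} (f : Fin j → Fin n) → (∀ {a b} → f a ≡ f b → a ≡ b) → ∣ imageOf f ∣ ≡ j
∣imageOf∣ f inj = ≤-antisym (∣imageOf∣≤ f) (injection-≤ (imageOf f) f inj (∈-imageOf f))

injection-onto : ∀ {j n} (S : Subset n) → ∣ S ∣ ≤ j → (f : Fin j → Fin n) → (∀ {a b} → f a ≡ f b → a ≡ b) →
                 (∀ i → f i ∈ˢ S) → ∀ {x} → x ∈ˢ S → ∃[ i ] f i ≡ x
injection-onto {j} {n} S S≤j f inj f∈ {x} x∈ with any? (λ i → f i Fin.≟ x)
... | yes p = p
... | no ¬p = ⊥-elim (<-irrefl refl (≤-trans (injection-≤ S g g-injective g∈) S≤j))
  where
  g : Fin (suc j) → Fin n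
  g fzero    = x
  g (fsuc i) = f i
  g-injective : ∀ {a b} → g a ≡ g b → a ≡ b
  g-injective {fzero} {fzero}  e = refl
  g-injective {fzero} {fsuc b} e = ⊥-elim (¬p (b , sym e))
  g-injective {fsuc a} {fzero}  e = ⊥-elim (¬p (a , e))
  g-injective {fsuc a} {fsuc b} e = cong fsuc (inj e)
  g∈ : ∀ i → g i ∈ˢ S
  g∈ fzero    = x∈
  g∈ (fsuc i) = f∈ i

-- Bases only depend on the tables of the generators.

tabulate-injective : ∀ {A : Set} {n} {f g : Fin n → A} → tabulate f ≡ tabulate g → ∀ i → f i ≡ g i
tabulate-injective e fzero    = ∷-injectiveˡ e
tabulate-injective e (fsuc i) = tabulate-injective (∷-injectiveʳ e) i

permTable-injective : ∀ {n} {π ρ : Permutation′ n} → permTable π ≡ permTable ρ → π ≈ ρ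
permTable-injective e = tabulate-injective (map-injective toℕ-injective e)

generated-⊆ : ∀ {n} {A B : Generators n} → (∀ {π} → π ∈ A → ∃[ ρ ] ρ ∈ B × ρ ≈ π) →
              ∀ {π} → Generated A π → Generated B π
generated-⊆ A⊆B (gen π∈)   = let _ , ρ∈ , ρ≈π = A⊆B π∈ in resp ρ≈π (gen ρ∈)
generated-⊆ A⊆B id         = id
generated-⊆ A⊆B (comp p q) = comp (generated-⊆ A⊆B p) (generated-⊆ A⊆B q)
generated-⊆ A⊆B (inv p)    = inv (generated-⊆ A⊆B p)
generated-⊆ A⊆B (resp e p) = resp e (generated-⊆ A⊆B p)

isBase-table : ∀ {n} {A B : Generators n} → map permTable A ≡ map permTable B →
               ∀ {S} → IsBase A S → IsBase B S
isBase-table {A = A} {B} e base π p = base π (generated-⊆ B⊆A p)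
  where
  B⊆A : ∀ {π} → π ∈ B → ∃[ ρ ] ρ ∈ A × ρ ≈ π
  B⊆A {π} π∈ with ∈-map⁻ permTable (subst (_ ∈_) (sym e) (∈-map⁺ permTable π∈))
  ... | ρ , ρ∈ , eq = ρ , ρ∈ , permTable-injective {π = ρ} {π} (sym eq)

-- The tree determines the number of points and the tables, hence the generators only up to `≈`;
-- this suffices to carry a base over.
baseSize-yes : ∀ {𝒞 : Group 0ℓ 0ℓ → Set} {n} (A : Generators n) k → 𝒞 (generatedGroup A) →
  ParamProblem.Yes (BaseSizeOn 𝒞) (codeGenerators A) k ⇔ (∃[ S ] ∣ S ∣ ≡ k × IsBase A S)
baseSize-yes {𝒞} {n} A k A∈ = mk⇔ to (λ (S , size , base) → n , A , refl , A∈ , S , size , base)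
  where
  to : ParamProblem.Yes (BaseSizeOn 𝒞) (codeGenerators A) k → ∃[ S ] ∣ S ∣ ≡ k × IsBase A S
  to (n′ , B , e , _ , S , size , base) with
    code-injective (nat ⊗ list (list nat)) (trans (sym (codeGenerators-≡ A)) (trans e (codeGenerators-≡ B)))
  ... | e′ with cong proj₁ e′
  ... | refl = S , size , isBase-table {A = B} {A} (sym (cong proj₂ e′)) {S} base

mini3SAT-yes : ∀ {k n F} → Is3CNF F → SizeBound k n F →
  ParamProblem.Yes Mini3SAT (codeMini3SAT n F) k ⇔ (∃[ α ] Satisfies α F)
mini3SAT-yes {k} {n} {F} is3 bound = mk⇔ to (λ sat → n , F , refl , is3 , bound , sat)
  where
  to : ParamProblem.Yes Mini3SAT (codeMini3SAT n F) k → ∃[ α ] Satisfies α F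
  to (n′ , F′ , e , _ , _ , sat) with code-injective (nat ⊗ list (list literal)) {n , F} {n′ , F′} e
  ... | refl = sat

-- Bases and coverings

module Correctness {k n F} (bound : SizeBound k n F) where

  open Cover {k} {n} {F} bound

  -- One label for the block and two for each of its `s` places.
  D : ℕ
  D = suc (s * 2)

  open Action D (allRows m) (allRows-row-length m) public

  occurs : ∀ {u} → u < m → ∃[ r ] r ∈ allRows m × u ∈ r
  occurs {u} u<m = let r , r∈ , u∈ = rowsOf-inhabited u in r , allRows-∈⁺ u<m r∈ , u∈

  open Elements m occurs public

  owner : ∀ {i r} → i < k → r ∈ allRows m → i ∈ r → r ∈ rowsOf i
  owner {i} {r} i<k r∈ i∈ with allRows-∈⁻ m r∈
  ... | u , _ , r∈u with rowsOf-labels r∈u i∈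
  ... | inj₁ refl      = r∈u
  ... | inj₂ (k≤i , _) = ⊥-elim (<-irrefl refl (<-≤-trans i<k k≤i))

  owner-≡ : ∀ {i j r} → i < k → r ∈ rowsOf j → i ∈ r → i ≡ j
  owner-≡ i<k r∈ i∈ with rowsOf-labels r∈ i∈
  ... | inj₁ e         = e
  ... | inj₂ (k≤i , _) = ⊥-elim (<-irrefl refl (<-≤-trans i<k k≤i))

  -- For each `i < k` some base point covers the block label `i`, and it must lie in block `i`.
  -- These `k` points are distinct and so exhaust `S`: no block holds a second base point, and the
  -- blocks from `k` on hold none.
  base⇒rowCover : ∀ S → ∣ S ∣ ≡ k → IsBase A S → RowCover
  base⇒rowCover S size base = record
    { chosen   = chosen
    ; chosen-∈ = λ {i} i<k → subst (λ i → chosen i ∈ rowsOf i) (toℕ-fromℕ< i<k)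
        (subst (_∈ rowsOf (toℕ (fromℕ< i<k))) (sym (chosen-≡ (fromℕ< i<k)))
          (owner (toℕ<n (fromℕ< i<k)) (rowOf-∈ (toℕ<n (f (fromℕ< i<k)))) (∈-row (fromℕ< i<k))))
    ; covers   = λ {u} u<m → let x , x∈ , u∈ = base⇒covers S base u<m
                                 i , e = injection-onto S (≤-reflexive size) f f-injective (λ i → proj₁ (proj₂ (point i))) x∈
                             in toℕ i , toℕ<n i , subst (u ∈_) (sym (trans (chosen-≡ i) (cong (rowOf ∘ toℕ) e))) u∈
    }
    where
    point : ∀ (i : Fin k) → ∃[ x ] x ∈ˢ S × toℕ i ∈ rowOf (toℕ x)
    point i = base⇒covers S base (<-≤-trans (toℕ<n i) k≤m)
    f : Fin k → Fin points
    f i = proj₁ (point i)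
    ∈-row : ∀ i → toℕ i ∈ rowOf (toℕ (f i))
    ∈-row i = proj₂ (proj₂ (point i))
    f-injective : ∀ {a b} → f a ≡ f b → a ≡ b
    f-injective {a} {b} e = toℕ-injective (owner-≡ (toℕ<n a)
      (owner (toℕ<n b) (rowOf-∈ (toℕ<n (f b))) (∈-row b))
      (subst (λ x → toℕ a ∈ rowOf (toℕ x)) e (∈-row a)))
    chosen : ℕ → Row
    chosen i with i <? k
    ... | yes i<k = rowOf (toℕ (f (fromℕ< i<k)))
    ... | no _    = []
    chosen-≡ : ∀ i → chosen (toℕ i) ≡ rowOf (toℕ (f i))
    chosen-≡ i with toℕ i <? k
    ... | yes p = cong (rowOf ∘ toℕ ∘ f) (fromℕ<-toℕ i p)
    ... | no ¬p = ⊥-elim (¬p (toℕ<n i))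

  rowCover⇒base : RowCover → ∃[ S ] ∣ S ∣ ≡ k × IsBase A S
  rowCover⇒base R = imageOf f , ∣imageOf∣ f f-injective , covers⇒base (imageOf f) λ u<m →
      let i , i<k , u∈ = covers u<m in f (fromℕ< i<k) , ∈-imageOf f (fromℕ< i<k) ,
        subst (_ ∈_) (sym (trans (f-row (fromℕ< i<k)) (cong chosen (toℕ-fromℕ< i<k)))) u∈
    where
    open RowCover R
    point : ∀ (i : Fin k) → ∃[ x ] rowOf (toℕ {points} x) ≡ chosen (toℕ i)
    point i = pointOf (allRows-∈⁺ (<-≤-trans (toℕ<n i) k≤m) (chosen-∈ (toℕ<n i)))
    f : Fin k → Fin points
    f i = proj₁ (point i)
    f-row : ∀ i → rowOf (toℕ (f i)) ≡ chosen (toℕ i)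
    f-row i = proj₂ (point i)
    -- The cover only says that some chosen row contains the block label; no row outside block `i`
    -- does.
    ∈-chosen : ∀ (i : Fin k) → toℕ i ∈ chosen (toℕ i)
    ∈-chosen i = let j , j<k , i∈ = covers (<-≤-trans (toℕ<n i) k≤m) in
      subst (λ j → toℕ i ∈ chosen j) (sym (owner-≡ (toℕ<n i) (chosen-∈ j<k) i∈)) i∈
    f-injective : ∀ {a b} → f a ≡ f b → a ≡ b
    f-injective {a} {b} e = toℕ-injective (owner-≡ (toℕ<n a) (chosen-∈ (toℕ<n b))
      (subst (toℕ a ∈_) (trans (sym (f-row a)) (trans (cong (rowOf ∘ toℕ) e) (f-row b))) (∈-chosen a)))

  base⇔satisfiable : (∃[ α ] Satisfies α F) ⇔ (∃[ S ] ∣ S ∣ ≡ k × IsBase A S)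
  base⇔satisfiable = mk⇔ (λ (α , sat) → rowCover⇒base (satisfiable⇒rowCover α sat))
    (λ (S , size , base) → rowCover⇒satisfiable (base⇒rowCover S size base))

  reduction-≡ : ⟦ reduction ⟧ ((n , F) , k) ≡ (generatorsValue A , k)
  reduction-≡ = cong (_, k) (trans (cong (λ U → ⟦ emit ⟧ (U , proj₂ (⟦ pieces ⟧ (s , (U , ⟦ decorate ⟧ W)))))
    (countdown-≡ m)) (emit-≡ D (allRows m) (allRows-row-length m) m))

-- Bounds on the lengths of the lists

short-if : ∀ b {P Q : Set} → P → Q → ifᵇ b then P else Q
short-if true  p q = p
short-if false p q = q

short-step : ∀ {G A S M} {f : Fn (G ⊗ (A ⊗ S)) S} {c s} as →
             (∀ {a} as′ → a ∈ as → length as′ < length as → Short M f (c , a , ⟦ fold f ⟧ (c , as′ , s))) →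
             ShortFold M f c as s
short-step []       h = tt
short-step (a ∷ as) h = short-step as (λ as′ a∈ l< → h as′ (there a∈) (m≤n⇒m≤1+n l<)) , h as (here refl) ≤-refl

short-any : ∀ {G A S M} {f : Fn (G ⊗ (A ⊗ S)) S} {c s} as → (∀ {a s} → a ∈ as → Short M f (c , a , s)) →
            ShortFold M f c as s
short-any as h = short-step as (λ _ a∈ _ → h a∈)

replicate-≤ : ∀ {n M} → n ≤ M → length (replicate n false) ≤ M
replicate-≤ {n} n≤M = ≤-trans (≤-reflexive (length-replicate n)) n≤M

short-monus : ∀ {M a b} → a ≤ M → Short M monus (a , b)
short-monus {a = a} a≤ = tt , replicate-≤ a≤ , short-any (replicate a false) (λ _ → tt)

short-isZero : ∀ {M n} → n ≤ M → Short M isZero n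
short-isZero {n = n} n≤ = tt , replicate-≤ n≤ , short-any (replicate n false) (λ _ → tt)

monus-≤ : ∀ {M a b} → b ≤ M → ⟦ monus ⟧ (a , b) ≤ M
monus-≤ {a = a} {b} b≤ = ≤-trans (≤-reflexive (monus-≡ a b)) (≤-trans (m∸n≤m b a) b≤)

short-equal : ∀ {M a b} → a ≤ M → b ≤ M → Short M equal (a , b)
short-equal {a = a} {b} a≤ b≤ = (short-monus a≤ , short-isZero (monus-≤ {a = a} b≤)) ,
  short-if (⟦ isZero ⟧ (⟦ monus ⟧ (a , b))) (tt , short-monus b≤ , short-isZero (monus-≤ {a = b} a≤)) tt

short-append : ∀ {A M} {as bs : List ⟦ A ⟧ᵗ} → length as ≤ M → Short M (append {A}) (as , bs)
short-append {as = as} as≤ = tt , as≤ , short-any as (λ _ → tt)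

short-headOr : ∀ {A M} {d} {as : List ⟦ A ⟧ᵗ} → length as ≤ M → Short M (headOr {A}) (d , as)
short-headOr {as = as} as≤ = tt , as≤ , short-any as (λ _ → tt)

short-double : ∀ {M n} → n ≤ M → Short M double n
short-double {n = n} n≤ = tt , replicate-≤ n≤ , short-any (replicate n false) (λ _ → tt)

short-len : ∀ {A M} {as : List ⟦ A ⟧ᵗ} → length as ≤ M → Short M (len {A}) as
short-len {as = as} as≤ = tt , as≤ , short-any as (λ _ → tt)

short-countdown : ∀ {M n} → n ≤ M → Short M countdown n
short-countdown {n = n} n≤ = (tt , replicate-≤ n≤ , short-any (replicate n false) (λ _ → tt)) , tt

VarsBelow : ℕ → List Slot → Set
VarsBelow M W = length W ≤ M × (∀ {w} → w ∈ W → vari w ≤ M)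

short-findSlot : ∀ {M x d W} → x ≤ M → VarsBelow M W → Short M findSlot ((x , d) , W)
short-findSlot {x = x} {d} {W} x≤ (W≤ , vars) = tt , W≤ ,
  short-any W λ {w} w∈ → (tt , short-equal x≤ (vars w∈)) , short-if (⟦ equal ⟧ (x , vari w)) tt tt

short-flatten : ∀ {M F k} → length F ≤ M → (∀ {C} → C ∈ F → length C ≤ M) → Short M flatten (F , k)
short-flatten {F = F} F≤ C≤ = tt , F≤ , short-any F λ {C} C∈ → tt , C≤ C∈ , short-any C (λ _ → tt)

short-labels : ∀ {M} w q → Short M labels (w , q)
short-labels w q = short-if (sign w) tt tt

short-decorate : ∀ {M W} → VarsBelow M W → Short M decorate W
short-decorate {M} {W} below = (tt , proj₁ below , go W (proj₁ below) (λ p → p)) , tt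
  where
  go : ∀ l → length l ≤ M → (∀ {w} → w ∈ l → w ∈ W) → ShortFold M decorateStep W l ([] , [])
  go []      _   _  = tt
  go (w ∷ l) l≤ l⊆ = go l (<⇒≤ l≤) (l⊆ ∘ there) ,
    ((((tt , short-findSlot w≤ below) ,
       (tt , short-findSlot w≤ (subst (VarsBelow M) (sym (cong proj₁ (decorateState-≡ W l)))
                                 (<⇒≤ l≤ , λ v∈ → proj₂ below (l⊆ (there v∈)))))) ,
      (tt , short-labels {M} w (⟦ next ⟧ (W , (w , decorateState W l))))) , tt)
    where
    w≤ = proj₂ below (l⊆ (here refl))

quotientState : ℕ → List Slot → ℕ × ℕ
quotientState k W = ⟦ fold quotientStep ⟧ (k , (W , (0 , 0)))

quotientState-≤ : ∀ k W → proj₂ (quotientState k W) ≤ k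
quotientState-≤ k []      = z≤n
quotientState-≤ k (w ∷ W) with quotientState k W | quotientState-≤ k W
... | s , zero  | _  = pred[n]≤n {k}
... | s , suc r | r≤ = <⇒≤ r≤

short-quotient : ∀ {M k W} → k ≤ M → length W ≤ M → Short M quotient (k , W)
short-quotient {M} {k} {W} k≤ W≤ = (tt , W≤ , go W) , tt
  where
  go : ∀ l → ShortFold M quotientStep k l (0 , 0)
  go []      = tt
  go (w ∷ l) = go l , (tt , short-isZero (≤-trans (quotientState-≤ k l) k≤)) ,
    short-if (⟦ isZero ⟧ (proj₂ (quotientState k l))) tt tt

short-extend : ∀ {M q R} → length R ≤ M → Short M extend (q , R)
short-extend {R = R} R≤ = tt , R≤ , short-any R (λ _ → tt)

2^-mono : ∀ {a b} → a ≤ b → 2 ^ a ≤ 2 ^ b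
2^-mono = ^-monoʳ-≤ 2

n<2^n : ∀ n → n < 2 ^ n
n<2^n zero    = s≤s z≤n
n<2^n (suc n) = ≤-trans (+-mono-≤ (m^n>0 2 n) (n<2^n n)) (≤-reflexive (cong (2 ^ n +_) (sym (+-identityʳ _))))

short-piece : ∀ {M s u D} → length D ≤ M → 2 ^ s ≤ M → Short M piece (s , (u , D))
short-piece {M} {s} {u} {D} D≤ 2^s≤ = tt , replicate-≤ (≤-trans (<⇒≤ (n<2^n s)) 2^s≤) , go s 2^s≤
  where
  open Piece u D
  go : ∀ s → 2 ^ s ≤ M → ShortFold M pieceStep u (replicate s false) (D , (u ∷ []) ∷ [])
  go zero    _   = tt
  go (suc s) 2^≤ = go s 2^s≤′ ,
    (tt , short-headOr {decorated} (≤-trans (≤-reflexive (rest-length s)) (≤-trans (m∸n≤m (length D) s) D≤))) ,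
    (tt , short-extend (≤-trans (≤-reflexive (rows-length s)) 2^s≤′)) , tt
    where
    2^s≤′ = ≤-trans (2^-mono (n≤1+n s)) 2^≤

short-pieces : ∀ {M s m D} → m ≤ M → length D ≤ M → 2 ^ s ≤ M → Short M pieces (s , (downFrom m , D))
short-pieces {M} {s} {m} {D} m≤ D≤ 2^s≤ = tt , ≤-trans (≤-reflexive (length-downFrom m)) m≤ , go m
  where
  open Pieces s D
  go : ∀ m → ShortFold M piecesStep s (downFrom m) (D , [])
  go zero    = tt
  go (suc m) = go m ,
    (tt , short-piece {s = s} (≤-trans (≤-reflexive (remaining-length m)) (≤-trans (m∸n≤m (length D) (m * s)) D≤)) 2^s≤) ,
    (tt , short-append {row} (≤-trans (≤-reflexive (Piece.rows-length m (remaining m) s)) 2^s≤)) , tt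

short-expandStep : ∀ {M u ℓ ys} → u ≤ M → ℓ ≤ M → length ys ≤ M → (∀ {y} → y ∈ ys → y ≤ M) →
                   Short M expandStep (u , (ℓ , ys))
short-expandStep {u = u} {ℓ} {ys} u≤ ℓ≤ ys≤ y≤ = (tt , short-equal u≤ ℓ≤) , tt , ys≤ ,
  short-any ys λ y∈ → (tt , short-double (y≤ y∈)) , short-if (⟦ equal ⟧ (u , ℓ)) tt tt

expand-length : ∀ u r i → length (⟦ expand ⟧ (u , (r , i))) ≡ 2 ^ length r
expand-length u r i = trans (cong length (expand-≡ u r i)) (trans (length-map (act (unit u) r) (range (i * 2 ^ length r) (2 ^ length r))) (range-length (i * 2 ^ length r) (2 ^ length r)))

expand-< : ∀ u r i {y} → y ∈ ⟦ expand ⟧ (u , (r , i)) → y < suc i * 2 ^ length r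
expand-< u r i y∈ with ∈-map⁻ (act (unit u) r) (subst (_ ∈_) (expand-≡ u r i) y∈)
... | x , x∈ , refl = halves-<⁺ n {act (unit u) r x} {suc i} (subst (_< suc i) (sym (halves-act (unit u) r x))
  (halves-<⁻ n {x} {suc i} (≤-trans (proj₂ (All.lookup (range-bounds (i * 2 ^ n) (2 ^ n)) x∈))
    (≤-reflexive (+-comm (i * 2 ^ n) (2 ^ n))))))
  where
  n = length r

-- `double` folds over the unary code of a point, so `M` has to bound the points themselves and not
-- merely how many there are; `suc i * 2 ^ length r` bounds both.
short-expand : ∀ {M u r i} → u ≤ M → (∀ {ℓ} → ℓ ∈ r → ℓ ≤ M) → suc i * 2 ^ length r ≤ M →
               Short M expand (u , (r , i))
short-expand {M} {u} {r} {i} u≤ ℓ≤ N≤ = tt , ≤-trans (<⇒≤ (n<2^n (length r))) (≤-trans (m≤m+n _ _) N≤) , go r ℓ≤ N≤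
  where
  go : ∀ r → (∀ {ℓ} → ℓ ∈ r → ℓ ≤ M) → suc i * 2 ^ length r ≤ M → ShortFold M expandStep u r (i ∷ [])
  go []      _  _  = tt
  go (ℓ ∷ r) ℓ≤ N≤ = go r (ℓ≤ ∘ there) N≤′ ,
    short-expandStep u≤ (ℓ≤ (here refl))
      (≤-trans (≤-reflexive (expand-length u r i)) (≤-trans (m≤m+n _ _) N≤′))
      (λ y∈ → <⇒≤ (<-≤-trans (expand-< u r i y∈) N≤′))
    where
    N≤′ : suc i * 2 ^ length r ≤ M
    N≤′ = ≤-trans (*-monoʳ-≤ (suc i) (2^-mono (n≤1+n (length r)))) N≤

RowsBelow : ℕ → ℕ → List Row → Set
RowsBelow M D rows = (∀ {r} → r ∈ rows → length r ≡ D) × (∀ {r ℓ} → r ∈ rows → ℓ ∈ r → ℓ ≤ M) ×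
                     length rows * 2 ^ D ≤ M

short-table : ∀ {M D u rows} → u ≤ M → RowsBelow M D rows → Short M table (u , rows)
short-table {M} {D} {u} {rows} u≤ (len , ℓ≤ , N≤) =
  (tt , ≤-trans (m≤m*n (length rows) (2 ^ D) {{m^n≢0 2 D}}) N≤ , go rows len ℓ≤ N≤) , tt
  where
  go : ∀ rows → (∀ {r} → r ∈ rows → length r ≡ D) → (∀ {r ℓ} → r ∈ rows → ℓ ∈ r → ℓ ≤ M) →
       length rows * 2 ^ D ≤ M → ShortFold M tableStep u rows (0 , [])
  go []         _   _  _  = tt
  go (r ∷ rows) len ℓ≤ N≤ = go rows (len ∘ there) (ℓ≤ ∘ there) N≤′ ,
    (tt , short-expand {r = r} u≤ (ℓ≤ (here refl)) (≤-trans (≤-reflexive (cong₂ (λ i n → suc i * 2 ^ n)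
      (cong proj₁ state) (len (here refl)))) N≤)) ,
    (tt , short-append {nat} (≤-trans (≤-reflexive (trans (cong (length ∘ proj₂) state)
      (trans (length-map _ (range 0 (length rows * 2 ^ D))) (range-length 0 _)))) N≤′)) , tt
    where
    N≤′ : length rows * 2 ^ D ≤ M
    N≤′ = ≤-trans (m≤n+m _ (2 ^ D)) N≤
    state = tableState-≡ D u rows (len ∘ there)

short-emit : ∀ {M D m rows} → m ≤ M → RowsBelow M D rows → Short M emit (downFrom m , rows)
short-emit {M} {D} {m} {rows} m≤ below@(len , _ , N≤) =
  (tt , short-table {D = D} z≤n below , short-len {nat} (≤-trans (≤-reflexive (table-length D rows len 0)) N≤)) ,
  (tt , (tt , ≤-trans (≤-reflexive (length-downFrom m)) m≤ ,
    short-any (downFrom m) λ u∈ → (tt , short-table {D = D} (<⇒≤ (<-≤-trans (∈-downFrom⁻ u∈) m≤)) below) , tt)) , tt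

module ReductionCost {k n F} (bound : SizeBound k n F) where

  open Cover {k} {n} {F} bound
  open Numbering N

  short-reduction : ∀ {M} → k ≤ M → length F ≤ M → (∀ {C} → C ∈ F → length C ≤ M) →
    VarsBelow M W → m ≤ M → 2 ^ s ≤ M → m * 2 ^ s * 2 ^ suc (s * 2) ≤ M → Short M reduction ((n , F) , k)
  short-reduction {M} k≤ F≤ C≤ W≤ m≤ 2^s≤ N≤ =
    (((tt , short-flatten F≤ C≤) , tt) ,
     ((tt , short-decorate W≤) ,
      (tt , short-quotient k≤ (proj₁ W≤)) ,
      (tt , short-countdown m≤) ,
      (tt , subst (λ U → Short M pieces (s , (U , ⟦ decorate ⟧ W))) (sym (countdown-≡ m))
              (short-pieces {s = s} m≤ (≤-trans (≤-reflexive decorate-length) (proj₁ W≤)) 2^s≤)) , tt) ,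
     subst (λ U → Short M emit (U , proj₂ (⟦ pieces ⟧ (s , (U , ⟦ decorate ⟧ W))))) (sym (countdown-≡ m))
       (short-emit {D = suc (s * 2)} m≤ (allRows-row-length m , labels≤ , ≤-trans (≤-reflexive
         (cong (_* 2 ^ suc (s * 2)) (allRows-length m))) N≤))) , tt
    where
    labels≤ : ∀ {r ℓ} → r ∈ allRows m → ℓ ∈ r → ℓ ≤ M
    labels≤ r∈ ℓ∈ with allRows-∈⁻ m r∈
    ... | u , u<m , r∈u with rowsOf-labels r∈u ℓ∈
    ... | inj₁ refl      = <⇒≤ (<-≤-trans u<m m≤)
    ... | inj₂ (_ , ℓ<m) = <⇒≤ (<-≤-trans ℓ<m m≤)

-- Sizes of codes

1≤size : ∀ t → 1 ≤ size t
1≤size nil     = ≤-refl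
1≤size (s ∙ t) = s≤s z≤n

size-codeℕ : ∀ n → size (codeℕ n) ≡ suc (2 * n)
size-codeℕ zero    = refl
size-codeℕ (suc n) = cong suc (trans (cong suc (size-codeℕ n)) (sym (*-suc 2 n)))

n≤size : ∀ n → n ≤ size (codeℕ n)
n≤size n = ≤-trans (m≤m+n n (n + 0)) (≤-trans (n≤1+n _) (≤-reflexive (sym (size-codeℕ n))))

length≤size : ∀ {A : Set} (c : A → Tree) as → length as ≤ size (codeList c as)
length≤size c []       = z≤n
length≤size c (a ∷ as) = s≤s (≤-trans (length≤size c as) (m≤n+m _ _))

∈-size : ∀ {A : Set} (c : A → Tree) {a as} → a ∈ as → size (c a) ≤ size (codeList c as)
∈-size c (here refl) = m≤n⇒m≤1+n (m≤m+n _ _)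
∈-size c (there a∈)  = m≤n⇒m≤1+n (≤-trans (∈-size c a∈) (m≤n+m _ _))

formulaSize≤size : ∀ F → formulaSize F ≤ size (codeList (codeList codeLiteral) F)
formulaSize≤size []      = z≤n
formulaSize≤size (C ∷ F) = s≤s (+-mono-≤ (length≤size codeLiteral C) (formulaSize≤size F))

size-codeList-≤ : ∀ {A : Set} (c : A → Tree) b as → (∀ {a} → a ∈ as → size (c a) ≤ b) →
                  size (codeList c as) ≤ 1 + length as * (1 + b)
size-codeList-≤ c b []       _ = ≤-refl
size-codeList-≤ c b (a ∷ as) h = s≤s (≤-trans (+-mono-≤ (h (here refl)) (size-codeList-≤ c b as (h ∘ there)))
  (≤-reflexive (+-suc b (length as * (1 + b)))))

size-codeGenerators-≤ : ∀ {n} (A : Generators n) M → n ≤ M → length A ≤ M →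
                        size (codeGenerators A) ≤ 8 * suc M ^ 3
size-codeGenerators-≤ {n} A M n≤M A≤M = begin
  suc (size (codeℕ n) + size (codeList codePermutation A))
    ≤⟨ s≤s (+-mono-≤ (point≤ n≤M) (size-codeList-≤ codePermutation B A (λ {π} _ → perm≤ π))) ⟩
  suc (suc (2 * M) + (1 + length A * (1 + B)))
    ≤⟨ s≤s (+-monoʳ-≤ (suc (2 * M)) (s≤s (*-monoˡ-≤ (1 + B) A≤M))) ⟩
  suc (suc (2 * M) + (1 + M * (1 + B)))
    -- The added polynomial is the difference of the two sides.
    ≤⟨ m≤m+n _ (6 * M * M * M + 22 * M * M + 20 * M + 5) ⟩
  suc (suc (2 * M) + (1 + M * (1 + B))) + (6 * M * M * M + 22 * M * M + 20 * M + 5)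
    ≡⟨ lem M ⟩
  8 * suc M ^ 3 ∎
  where
  open ≤-Reasoning
  B : ℕ
  B = 1 + M * (1 + suc (2 * M))
  lem : ∀ M → suc (suc (2 * M) + (1 + M * (1 + (1 + M * (1 + suc (2 * M)))))) +
              (6 * M * M * M + 22 * M * M + 20 * M + 5) ≡ 8 * (suc M * (suc M * (suc M * 1)))
  lem = solve-∀
  point≤ : ∀ {i} → i ≤ M → size (codeℕ i) ≤ suc (2 * M)
  point≤ {i} i≤ = ≤-trans (≤-reflexive (size-codeℕ i)) (s≤s (*-monoʳ-≤ 2 i≤))
  perm≤ : ∀ π → size (codePermutation π) ≤ B
  perm≤ π = ≤-trans (size-codeList-≤ (codeℕ ∘ toℕ) (suc (2 * M)) (tabulate (π ⟨$⟩ʳ_))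
      (λ {i} _ → point≤ (≤-trans (<⇒≤ (toℕ<n i)) n≤M)))
    (s≤s (*-monoˡ-≤ (1 + suc (2 * M)) (≤-trans (≤-reflexive (length-tabulate (π ⟨$⟩ʳ_))) n≤M)))

numbered-∈ : ∀ h p C {w} → w ∈ numbered h p C → proj₁ w ∈ C
numbered-∈ h p (ℓ ∷ C) (here refl) = here refl
numbered-∈ h p (ℓ ∷ C) (there w∈)  = there (numbered-∈ h p C w∈)

flatten-∈ : ∀ k F {w} → w ∈ proj₂ (⟦ flatten ⟧ (F , k)) → ∃[ C ] C ∈ F × proj₁ w ∈ C
flatten-∈ k (C ∷ F) w∈ with ∈-++⁻ (numbered h (suc h) C)
  (subst (_ ∈_) (cong proj₂ (flattenClause-≡ h C (suc h) (proj₂ (⟦ flatten ⟧ (F , k))))) w∈)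
  where h = proj₁ (⟦ flatten ⟧ (F , k))
... | inj₁ p = C , here refl , numbered-∈ _ _ C p
... | inj₂ p with flatten-∈ k F p
... | D , D∈ , ℓ∈ = D , there D∈ , ℓ∈

-- The cost of the reduction

PolynomialCost : ∀ {A B} → Fn A B → ℕ → ℕ → Set
PolynomialCost f c e = ∀ M → cost M f ≤ c * suc M ^ e × 8 * suc M ^ 3 ≤ c * suc M ^ e

polynomialCost : ∀ {A B} (f : Fn A B) → ∃[ c ] ∃[ e ] PolynomialCost f c e
polynomialCost f = coeff f + 8 , deg f + 3 , λ M →
  ≤-trans (m≤m+n (cost M f) (8 * suc M ^ 3)) (^-+-≤ (suc M) (coeff f) 8 (deg f) 3) ,
  ≤-trans (m≤n+m (8 * suc M ^ 3) (cost M f)) (^-+-≤ (suc M) (coeff f) 8 (deg f) 3)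

-- The coefficient and the degree of the bound are numerals which must not be unfolded.

abstract
  reductionCost : ∃[ c ] ∃[ e ] PolynomialCost reduction c e
  reductionCost = polynomialCost reduction

coeffᴿ degᴿ : ℕ
coeffᴿ = proj₁ reductionCost
degᴿ   = proj₁ (proj₂ reductionCost)

-- The base `17 * suc k` comes from `1 + 16 * (k + z) * z ^ 3 ≤ 17 * (k + 1) * z ^ 4` for `z ≥
-- 1`, whose left side is `suc (lengthBound k z)`.
factor : ℕ → ℕ
factor k = coeffᴿ * (17 * suc k) ^ degᴿ

exponent : ℕ
exponent = 4 * degᴿ

factor-mono : ∀ {k k′} → k ≤ k′ → factor k ≤ factor k′
factor-mono k≤ = *-monoʳ-≤ coeffᴿ (^-monoˡ-≤ degᴿ (*-monoʳ-≤ 17 (s≤s k≤)))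

-- The number of points is `m * 2 ^ s * 2 ^ suc (s * 2)`; here `m` is replaced by `k + z` and
-- `2 ^ s` by `2 * z`, where `z` is the size of the input.
lengthBound : ℕ → ℕ → ℕ
lengthBound k z = (k + z) * (2 * z) * (2 * (2 * z * (2 * z)))

lengthBound-≤ : ∀ k z → 1 ≤ z → coeffᴿ * suc (lengthBound k z) ^ degᴿ ≤ factor k * z ^ exponent
lengthBound-≤ k z 1≤z = begin
  coeffᴿ * suc (lengthBound k z) ^ degᴿ
    ≤⟨ *-monoʳ-≤ coeffᴿ (^-monoˡ-≤ degᴿ step) ⟩
  coeffᴿ * (17 * suc k * z ^ 4) ^ degᴿ
    ≡⟨ cong (coeffᴿ *_) (*-^ (17 * suc k) (z ^ 4) degᴿ) ⟩
  coeffᴿ * ((17 * suc k) ^ degᴿ * (z ^ 4) ^ degᴿ)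
    ≡⟨ cong (λ x → coeffᴿ * ((17 * suc k) ^ degᴿ * x)) (^-*-assoc z 4 degᴿ) ⟩
  coeffᴿ * ((17 * suc k) ^ degᴿ * z ^ exponent)
    ≡⟨ sym (*-assoc coeffᴿ ((17 * suc k) ^ degᴿ) (z ^ exponent)) ⟩
  factor k * z ^ exponent ∎
  where
  open ≤-Reasoning
  cube : ∀ b z → b * (2 * z) * (2 * (2 * z * (2 * z))) ≡ b * (16 * (z * z * z))
  cube = solve-∀
  collect : ∀ k z → suc k * (z * (z * (z * (z * 1)))) + suc k * z * (16 * (z * z * z)) ≡
                    17 * suc k * (z * (z * (z * (z * 1))))
  collect = solve-∀
  step : suc (lengthBound k z) ≤ 17 * suc k * z ^ 4
  step = begin
    1 + lengthBound k z
      ≤⟨ +-mono-≤ (*-mono-≤ {1} {suc k} {1} {z ^ 4} (s≤s z≤n) (m^n>0 z {{>-nonZero 1≤z}} 4))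
           (≤-reflexive (cube (k + z) z)) ⟩
    suc k * z ^ 4 + (k + z) * (16 * (z * z * z))
      ≤⟨ +-monoʳ-≤ (suc k * z ^ 4) (*-monoˡ-≤ (16 * (z * z * z)) k+z≤) ⟩
    suc k * z ^ 4 + suc k * z * (16 * (z * z * z))
      ≡⟨ collect k z ⟩
    17 * suc k * z ^ 4 ∎
    where
    k+z≤ : k + z ≤ suc k * z
    k+z≤ = ≤-trans (+-monoˡ-≤ z (m≤m*n k z {{>-nonZero 1≤z}})) (≤-reflexive (+-comm (k * z) z))

2^-suc-double : ∀ s → 2 ^ suc (s * 2) ≡ 2 * (2 ^ s * 2 ^ s)
2^-suc-double s = cong (2 *_) (trans (sym (^-*-assoc 2 s 2)) (cong (2 ^ s *_) (*-identityʳ (2 ^ s))))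

-- Time and output size in terms of the input

module Reduces {k n F} (is3 : Is3CNF F) (bound : SizeBound k n F) where

  open Correctness {k} {n} {F} bound using (A; reduction-≡; base⇔satisfiable)
  open Cover {k} {n} {F} bound using (m; W; s; N; s-spec; allRows-length)
  open Numbering N

  z M : ℕ
  z = size (codeMini3SAT n F)
  M = lengthBound k z

  1≤z : 1 ≤ z
  1≤z = s≤s z≤n

  formula≤z : size (codeList (codeList codeLiteral) F) ≤ z
  formula≤z = m≤n⇒m≤1+n (m≤n+m _ _)

  instance
    z≢0 : NonZero z
    z≢0 = >-nonZero 1≤z

  k+z≤M : k + z ≤ M
  k+z≤M = ≤-trans (m≤m*n (k + z) (2 * z) {{m*n≢0 2 z}})
    (m≤m*n ((k + z) * (2 * z)) _ {{m*n≢0 2 _ {{it}} {{m*n≢0 (2 * z) (2 * z) {{m*n≢0 2 z}} {{m*n≢0 2 z}}}}}})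

  2^s≤ : 2 ^ s ≤ 2 * z
  2^s≤ = ≤-trans (proj₂ s-spec) (*-monoʳ-≤ 2 (≤-trans (n≤size n) (m≤n⇒m≤1+n (m≤m+n _ _))))

  z≤M : z ≤ M
  z≤M = ≤-trans (m≤n+m z k) k+z≤M

  m≤k+z : m ≤ k + z
  m≤k+z = ≤-trans (≤-reflexive size-≡) (≤-trans (≤-reflexive (+-comm (formulaSize F) k))
    (+-monoʳ-≤ k (≤-trans (formulaSize≤size F) formula≤z)))

  N≤M : m * 2 ^ s * 2 ^ suc (s * 2) ≤ M
  N≤M = *-mono-≤ (*-mono-≤ m≤k+z 2^s≤)
    (≤-trans (≤-reflexive (2^-suc-double s)) (*-monoʳ-≤ 2 (*-mono-≤ 2^s≤ 2^s≤)))

  2^s≤M : 2 ^ s ≤ M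
  2^s≤M = ≤-trans 2^s≤ (≤-trans (m≤n*m (2 * z) (k + z) {{>-nonZero (≤-trans 1≤z (m≤n+m z k))}})
    (m≤m*n ((k + z) * (2 * z)) _ {{m*n≢0 2 _ {{it}} {{m*n≢0 (2 * z) (2 * z) {{m*n≢0 2 z}} {{m*n≢0 2 z}}}}}}))

  vars : ∀ {w} → w ∈ W → vari w ≤ z
  vars {w} w∈ with flatten-∈ k F w∈
  ... | C , C∈ , ℓ∈ = ≤-trans (≤-trans (≤-trans (n≤size (vari w)) (m≤n⇒m≤1+n (m≤n+m _ _)))
    (∈-size codeLiteral ℓ∈)) (≤-trans (∈-size (codeList codeLiteral) C∈) formula≤z)

  short : Short M reduction ((n , F) , k)
  short = ReductionCost.short-reduction {k} {n} {F} bound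
    (≤-trans (m≤m+n k z) k+z≤M)
    (≤-trans (≤-trans (length≤size (codeList codeLiteral) F) formula≤z) z≤M)
    (λ C∈ → ≤-trans (≤-trans (length≤size codeLiteral _) (≤-trans (∈-size (codeList codeLiteral) C∈) formula≤z)) z≤M)
    (≤-trans length-≤ (≤-trans (≤-trans (formulaSize≤size F) formula≤z) z≤M) , λ w∈ → ≤-trans (vars w∈) z≤M)
    (≤-trans m≤k+z k+z≤M)
    2^s≤M
    N≤M

  runs : Runs (compile reduction) (codeMini3SAT n F ∙ codeℕ k) (codeGenerators A ∙ codeℕ k) (factor k * z ^ exponent)
  runs = runs-≤ (≤-trans (proj₁ (proj₂ (proj₂ reductionCost) M)) (lengthBound-≤ k z 1≤z))
    (subst (λ v → Runs (compile reduction) (codeMini3SAT n F ∙ codeℕ k) v (cost M reduction))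
      (trans (cong (code ((nat ⊗ list (list nat)) ⊗ nat)) reduction-≡) (cong (_∙ codeℕ k) (sym (codeGenerators-≡ A))))
      (compile-runs M reduction ((n , F) , k) short))

  output-size : size (codeGenerators A) ≤ factor k * z ^ exponent
  output-size = ≤-trans (size-codeGenerators-≤ A M
      (≤-trans (≤-reflexive (cong (_* 2 ^ suc (s * 2)) (allRows-length m))) N≤M)
      (≤-trans (≤-reflexive (trans (length-map _ (downFrom m)) (length-downFrom m))) (≤-trans m≤k+z k+z≤M)))
    (≤-trans (proj₂ (proj₂ (proj₂ reductionCost) M)) (lengthBound-≤ k z 1≤z))

  yes⇔yes : ∀ {𝒞 : Group 0ℓ 0ℓ → Set} → 𝒞 (generatedGroup A) →
    ParamProblem.Yes Mini3SAT (codeMini3SAT n F) k ⇔ ParamProblem.Yes (BaseSizeOn 𝒞) (codeGenerators A) k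
  yes⇔yes {𝒞} A∈ = ⇔-sym (baseSize-yes {𝒞} A k A∈) ⇔-∘ (base⇔satisfiable ⇔-∘ mini3SAT-yes {k} {n} {F} is3 bound)

-- Computable functions

computable-const : ∀ c → Computable (λ _ → c)
computable-const c = (X≔ constant c) , λ n → 1 , subst (λ y → Run (X≔ constant c) (codeℕ n) y 1) (eval-constant c n) assign
  where
  constant : ℕ → Expr
  constant zero    = nil
  constant (suc c) = cons nil (constant c)
  eval-constant : ∀ c n → eval (constant c) (codeℕ n) ≡ codeℕ c
  eval-constant zero    n = refl
  eval-constant (suc c) n = cong (nil ∙_) (eval-constant c n)

computable-id : Computable (λ n → n)
computable-id = (X≔ X) , λ n → 1 , assign

computable-∘ : ∀ {f g} → Computable f → Computable g → Computable (f ∘ g)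
computable-∘ (c , f) (d , g) = (d ⨟ c) , λ n → _ , seq (proj₂ (g n)) (proj₂ (f _))

-- `Computable` sets no time limit, so the bound `M` may depend on the arguments. The input is
-- duplicated, and each of the two programs runs on its copy under `frame`.
computable-⟦⟧ : (op : Fn (nat ⊗ nat) nat) → (∀ a b → ∃[ M ] Short M op (a , b)) →
                ∀ {f g} → Computable f → Computable g → Computable (λ n → ⟦ op ⟧ (f n , g n))
computable-⟦⟧ op short (c , f) (d , g) =
  (X≔ cons X X ⨟ frame d ⨟ X≔ cons (tl X) (hd X) ⨟ frame c ⨟ compile op) , λ n →
    _ , seq assign (seq (run-frame _ (proj₂ (g n))) (seq assign (seq (run-frame _ (proj₂ (f n)))
      (proj₁ (proj₂ (compile-runs _ op _ (proj₂ (short _ _))))))))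

computable-cong : ∀ {f g} → (∀ n → f n ≡ g n) → Computable f → Computable g
computable-cong e (c , f) = c , λ n → _ , subst (λ y → Run c (codeℕ n) (codeℕ y) _) (e n) (proj₂ (f n))

add mult : Fn (nat ⊗ nat) nat
add  = expr (pair var (pair (unary (fst var)) (snd var))) ⟫ fold (expr (sucₑ (snd (snd var))))
mult = expr (pair (snd var) (pair (unary (fst var)) zeroₑ)) ⟫ fold (expr (pair (fst var) (snd (snd var))) ⟫ add)

add-≡ : ∀ a b → ⟦ add ⟧ (a , b) ≡ a + b
add-≡ zero    b = refl
add-≡ (suc a) b = cong suc (add-≡ a b)

mult-≡ : ∀ a b → ⟦ mult ⟧ (a , b) ≡ a * b
mult-≡ zero    b = refl
mult-≡ (suc a) b = trans (add-≡ b (⟦ mult ⟧ (a , b))) (cong (b +_) (mult-≡ a b))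

short-add : ∀ {M a b} → a ≤ M → Short M add (a , b)
short-add {a = a} a≤ = tt , replicate-≤ a≤ , short-any (replicate a false) (λ _ → tt)

computable-+ : ∀ {f g} → Computable f → Computable g → Computable (λ n → f n + g n)
computable-+ {f} {g} cf cg = computable-cong (λ n → add-≡ (f n) (g n))
  (computable-⟦⟧ add (λ a b → a , short-add ≤-refl) cf cg)

computable-* : ∀ {f g} → Computable f → Computable g → Computable (λ n → f n * g n)
computable-* {f} {g} cf cg = computable-cong (λ n → mult-≡ (f n) (g n))
  (computable-⟦⟧ mult (λ a b → a + b , tt , replicate-≤ (m≤m+n a b) ,
    short-any (replicate a false) (λ _ → tt , short-add (m≤n+m b a))) cf cg)

computable-^ : ∀ {f} e → Computable f → Computable (λ n → f n ^ e)
computable-^ zero    cf = computable-const 1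
computable-^ (suc e) cf = computable-* cf (computable-^ e cf)

computable-factor : Computable factor
computable-factor = computable-* (computable-const coeffᴿ)
  (computable-^ degᴿ (computable-* (computable-const 17) (computable-+ (computable-const 1) computable-id)))

-- Composition of reductions

factor-^-≤ : ∀ {k k′ a z z′} d → k′ ≤ k → z′ ≤ a * z ^ d →
             factor k′ * z′ ^ exponent ≤ factor k * a ^ exponent * z ^ (d * exponent)
factor-^-≤ {k} {k′} {a} {z} {z′} d k′≤ z′≤ = begin
  factor k′ * z′ ^ exponent
    ≤⟨ *-mono-≤ (factor-mono k′≤) (^-monoˡ-≤ exponent z′≤) ⟩
  factor k * (a * z ^ d) ^ exponent
    ≡⟨ cong (factor k *_) (trans (*-^ a (z ^ d) exponent) (cong (a ^ exponent *_) (^-*-assoc z d exponent))) ⟩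
  factor k * (a ^ exponent * z ^ (d * exponent))
    ≡⟨ sym (*-assoc (factor k) (a ^ exponent) (z ^ (d * exponent))) ⟩
  factor k * a ^ exponent * z ^ (d * exponent) ∎
  where open ≤-Reasoning

-- Hardness for every class of groups that contains the elementary 2-groups

module _ (𝒞 : Group 0ℓ 0ℓ → Set) (elementary⇒𝒞 : ∀ {G} → IsElementary2Group G → 𝒞 G) where

  reduction-reduces : ∀ t k → ParamProblem.Input Mini3SAT t k → ∃[ t′ ]
    Runs (compile reduction) (t ∙ codeℕ k) (t′ ∙ codeℕ k) (factor k * size t ^ exponent) ×
    size t′ ≤ factor k * size t ^ exponent ×
    ParamProblem.Input (BaseSizeOn 𝒞) t′ k ×
    (ParamProblem.Yes Mini3SAT t k ⇔ ParamProblem.Yes (BaseSizeOn 𝒞) t′ k)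
  reduction-reduces t k (n , F , refl , is3 , bound) =
    codeGenerators A , runs , output-size , (points , A , refl , A∈) , yes⇔yes {𝒞} A∈
    where
    open Reduces {k} {n} {F} is3 bound
    open Correctness {k} {n} {F} bound using (A; isElementary2; points)
    A∈ : 𝒞 (generatedGroup A)
    A∈ = elementary⇒𝒞 {generatedGroup A} isElementary2

  -- The second reduction keeps the parameter `k₁` of the intermediate instance, and its cost
  -- depends on `k₁`, whereas the bound must depend on `k` alone; as `k₁ ≤ g k`, monotonicity of
  -- `factor` gives `factor (g k)`.
  baseSize-hard : MINI[1]-hard (BaseSizeOn 𝒞)
  baseSize-hard P r = record
    { program      = program ⨟ compile reduction
    ; f            = λ k → f k + factor (g k) * f k ^ exponent
    ; g            = g
    ; d            = d + d * exponent
    ; f-computable = computable-+ f-computable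
        (computable-* (computable-∘ computable-factor g-computable) (computable-^ exponent f-computable))
    ; g-computable = g-computable
    ; reduces      = λ t k input →
        let t₁ , k₁ , σ , run₁ , σ≤ , size₁≤ , k₁≤ , input₁ , iff₁ = reduces t k input
            t₂ , (τ , run₂ , τ≤) , size₂≤ , input₂ , iff₂ = reduction-reduces t₁ k₁ input₁
            second≤ = factor-^-≤ {g k} {k₁} {f k} {size t} {size t₁} d k₁≤ size₁≤
            sum≤ = ^-+-≤ (size t) {{>-nonZero (1≤size t)}} (f k) (factor (g k) * f k ^ exponent) d (d * exponent)
        in t₂ , k₁ , σ + τ , seq run₁ run₂ ,
           ≤-trans (+-mono-≤ σ≤ (≤-trans τ≤ second≤)) sum≤ ,
           ≤-trans size₂≤ (≤-trans second≤ (≤-trans (m≤n+m _ (f k * size t ^ d)) sum≤)) ,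
           k₁≤ , input₂ , iff₂ ⇔-∘ iff₁
    }
    where open _≤fpt_ r

theorem2p3 : MINI[1]-hard BaseSize × MINI[1]-hard BaseSizeElementary2
theorem2p3 = baseSize-hard (λ _ → ⊤) (λ _ → tt) , baseSize-hard IsElementary2Group (λ e → e)
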